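{- Let $a,b,c\in\mathbb{Z}^+$ with $v_2(b)\equiv v_2(c)\pmod 2$. Assume that $a'\equiv b'\equiv c'\pmod 4$ fails. Then either none of the forms $ax^2+by^2+2cT_z$ and $ax^2+cy^2+2bT_z$ is asymptotically universal, or none of the forms $ax^2+2cy^2+bT_z$ and $ax^2+2by^2+cT_z$ is asymptotically universal.
   Context: $\mathbb{Z}^{+}=\{1,2,3,\ldots\}$. For $x\in\mathbb{Z}$, $T_x=x(x+1)/2$. A form $f(x,y,z)$ of the listed types (variables ranging over $\mathbb{Z}$) is asymptotically universal if $\lim_{N\to\infty}\frac1N|\{1\le n\le N: n=f(x,y,z)\text{ for some }x,y,z\in\mathbb{Z}\}|=1$. For a positive integer $n$, $v_2(n)$ is the 2-adic order of $n$ and $n'=n/2^{v_2(n)}$ is the odd part of $n$. -}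

module Defs where

open import Data.Fin.Base using (toℕ)
open import Data.Fin.Subset using (Subset; _∈_) renaming (∣_∣ to card)
open import Data.Integer.Base as ℤ using (ℤ; +_)
open import Data.Nat.Base using (ℕ; zero; suc; _≥_; _^_; _/_; _%_; NonZero)
open import Data.Nat.Divisibility using (_∣?_)
open import Data.Nat.Properties using (m^n≢0)
open import Data.Product.Base using (∃; _×_)
open import Data.Rational.Base as ℚ using (ℚ; 0ℚ; 1ℚ)
open import Function.Bundles using (_⇔_)
open import Level using (0ℓ)
open import Relation.Binary.PropositionalEquality.Core using (_≡_)
open import Relation.Nullary.Decidable.Core using (yes; no)
open import Relation.Unary using (Pred)

-- The first argument bounds the number of divisions by 2.  Since 2 ^ k ∣ n with
-- n positive forces k < n, the bound n is never reached in v₂ n.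
v₂-bounded : ℕ → ℕ → ℕ
v₂-bounded zero    n = 0
v₂-bounded (suc k) n with 2 ∣? n
... | yes _ = suc (v₂-bounded k (n / 2))
... | no  _ = 0

-- Only meaningful for positive arguments; v₂ 0 is 0.
v₂ : ℕ → ℕ
v₂ n = v₂-bounded n n

oddPart : ℕ → ℕ
oddPart n = _/_ n (2 ^ v₂ n) {{m^n≢0 2 (v₂ n)}}

infix 4 _≡_[mod_]

_≡_[mod_] : ℕ → ℕ → (m : ℕ) .{{_ : NonZero m}} → Set
a ≡ b [mod m ] = a % m ≡ b % m

T : ℤ → ℤ
T x = (x ℤ.* (x ℤ.+ + 1)) ℤ./ + 2

TernaryForm : Set
TernaryForm = ℤ → ℤ → ℤ → ℤ

-- form a b c x y z = a x² + b y² + c T_z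
form : ℕ → ℕ → ℕ → TernaryForm
form a b c x y z = + a ℤ.* x ℤ.^ 2 ℤ.+ + b ℤ.* y ℤ.^ 2 ℤ.+ + c ℤ.* T z

Represents : TernaryForm → Pred ℕ 0ℓ
Represents f n = ∃ λ x → ∃ λ y → ∃ λ z → + n ≡ f x y z

-- ∣ { 1 ≤ n ≤ N : P n } ∣ ≡ k, where i : Fin N stands for the integer i + 1.
-- The subset S, hence k, is determined by P and N.
Count : Pred ℕ 0ℓ → ℕ → ℕ → Set
Count P N k = ∃ λ (S : Subset N) →
  (∀ i → i ∈ S ⇔ P (suc (toℕ i))) × card S ≡ k

Tendsto : (ℕ → ℚ) → ℚ → Set
Tendsto u l = ∀ ε → 0ℚ ℚ.< ε → ∃ λ N₀ → ∀ N → N ≥ N₀ → ℚ.∣ u N ℚ.- l ∣ ℚ.< ε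

-- The sequence of proportions starts at N = 1, whence the shift to suc N.
-- Requiring a counting function is no restriction for form a b c with a, b, c
-- positive: it takes each value only on a bounded set of arguments, so that
-- Represents is decidable and the counting function exists and is unique.
AsymptoticallyUniversal : TernaryForm → Set
AsymptoticallyUniversal f = ∃ λ (count : ℕ → ℕ) →
  (∀ N → Count (Represents f) N (count N)) ×
  Tendsto (λ N → + count (suc N) ℚ./ suc N) 1ℚ

{-# OPTIONS --safe #-}

-- Completing the square, 8 (a x² + b y² + c T_z) + c = 8a x² + 8b y² + c (2z + 1)², and
-- up to a common factor and squares the coefficients on the right are odd A, B, C: the
-- odd parts of a, b, c, for one of the two pairs of forms.  A form of density 1 meets
-- every residue class, hence represents −ABC over ℤ_p for all odd p, which means that the
-- quaternion algebra (−BC, −AC) splits at p.  It splits at 2 as well, because A, B, C are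
-- not all congruent modulo 4.  But a definite quaternion algebra over ℚ does not split at
-- every prime.  This last fact is proved by Legendre's descent rather than by reciprocity:
-- splitting everywhere makes −a a square modulo a squarefree b ≥ a, and writing
-- t² + a = b b₁ with t ≤ b / 2 replaces (−a, −b) by (−a, −b₁) with b₁ < b, down to
-- (−1, −1), which does not split at 2.
module Submission where

open import Defs
open import Data.Bool.Base using (true; false)
open import Data.Empty using (⊥)
open import Data.Fin.Base using (Fin; toℕ; fromℕ<; _↑ˡ_; _↑ʳ_)
open import Data.Fin.Properties using (toℕ-fromℕ<; toℕ-↑ˡ; toℕ-↑ʳ; all?; any?)
open import Data.Fin.Subset using (Subset; _∈_; _∉_) renaming (∣_∣ to card)
open import Data.Fin.Subset.Properties using (_∈?_; ∈⊤; ∣⊤∣≡n; p⊂q⇒∣p∣<∣q∣)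
open import Data.Integer.Base as ℤ using (ℤ; +_)
  renaming (_+_ to _⊕_; _*_ to _⊗_; _-_ to _⊝_; -_ to ⊖_)
import Data.Integer.DivMod as ℤ
open import Data.Integer.Divisibility.Signed as ℤ
  using (∣ᵤ⇒∣; ∣⇒∣ᵤ; ∣n⇒∣m*n; ∣m⇒∣m*n; ∣m∣n⇒∣m+n; ∣m∣n⇒∣m-n; m∣∣m∣; *-cancelˡ-∣; *-cancelʳ-∣)
  renaming (_∣_ to _∣ℤ_; _∣?_ to _∣ℤ?_; ∣-trans to ∣ℤ-trans; ∣-refl to ∣ℤ-refl)
import Data.Integer.Properties as ℤ
open import Data.Integer.Tactic.RingSolver using (solve-∀)
open import Data.List.Base using ([]; _∷_)
open import Data.List.Relation.Unary.All using (All; []; _∷_)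
open import Data.Nat.Base
open import Data.Nat.Coprimality using (Coprime; coprime-Bézout)
open import Data.Nat.Divisibility
  using (_∣_; divides; _∣?_; m∣m*n; n∣m*n; ∣-trans; ∣-reflexive; *-monoʳ-∣; *-monoˡ-∣)
open import Data.Nat.DivMod using (m≡m%n+[m/n]*n; m%n<n; m%n%n≡m%n; [m+n]%n≡m%n; [m+kn]%n≡m%n; m*n/n≡m)
open import Data.Nat.GCD using (module Bézout)
open import Data.Nat.ListAction using (product)
open import Data.Nat.Primality
  using (Prime; euclidsLemma; prime[2]; prime⇒irreducible; prime⇒nonTrivial; prime⇒nonZero)
open import Data.Nat.Primality.Factorisation using (factorise; module PrimeFactorisation)
open import Data.Nat.Properties
import Data.Nat.Tactic.RingSolver as ℕ-Solver
open import Data.Product.Base using (∃; _×_; _,_; proj₁; proj₂)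
open import Data.Rational.Base as ℚ using (1ℚ; toℚᵘ)
import Data.Rational.Properties as ℚ
open import Data.Rational.Unnormalised.Base as ℚᵘ using (mkℚᵘ; *≤*)
import Data.Rational.Unnormalised.Properties as ℚᵘ
open import Data.Sum.Base using (_⊎_; inj₁; inj₂; [_,_]′) renaming (map to map⊎)
open import Data.Vec.Base using ([]; _∷_; _++_; splitAt)
open import Data.Vec.Properties using (lookup-++ˡ; lookup-++ʳ; []=⇒lookup; lookup⇒[]=)
open import Function.Base using (id)
open import Function.Bundles using (Equivalence)
open import Level using (0ℓ)
open import Relation.Binary.PropositionalEquality
  using (_≡_; _≢_; refl; sym; trans; cong; cong₂; subst; subst₂; module ≡-Reasoning)
open import Relation.Nullary.Decidable using (Dec; yes; no; from-yes; from-no; _→-dec_; _×-dec_)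
open import Relation.Nullary.Negation.Core using (¬_; contradiction)
open import Relation.Unary using (Pred)

-- Quaternion algebras over ℚ

-- The reduced norm of s + x i + y j + z ij in the quaternion algebra with i² = - a, j² = - b and ij
-- = - ji.
norm : (a b s x y z : ℤ) → ℤ
norm a b s x y z = s ⊗ s ⊕ a ⊗ (x ⊗ x) ⊕ b ⊗ (y ⊗ y) ⊕ a ⊗ b ⊗ (z ⊗ z)

-- The quaternion algebra (−a, −b) splits over ℚ_p: its norm form has p-adic zeros
-- with the fixed nonzero coordinate s.
SplitAt : (p a b : ℕ) → Set
SplitAt p a b = ∃ λ s → NonZero s ×
  (∀ k → ∃ λ x → ∃ λ y → ∃ λ z → + (p ^ k) ∣ℤ norm (+ a) (+ b) (+ s) x y z)

-- Arithmetic modulo a prime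

abstract
  p∣ℤm⊗n : ∀ {p} → Prime p → ∀ m n → + p ∣ℤ m ⊗ n → + p ∣ℤ m ⊎ + p ∣ℤ n
  p∣ℤm⊗n {p} pp m n d = map⊎ ∣ᵤ⇒∣ ∣ᵤ⇒∣
    (euclidsLemma ℤ.∣ m ∣ ℤ.∣ n ∣ pp (subst (p ∣_) (ℤ.abs-* m n) (∣⇒∣ᵤ d)))

  p∣ℤm⊗m : ∀ {p} → Prime p → ∀ m → + p ∣ℤ m ⊗ m → + p ∣ℤ m
  p∣ℤm⊗m pp m d = [ id , id ]′ (p∣ℤm⊗n pp m m d)

  prime∤⇒coprime : ∀ {p n} → Prime p → ¬ p ∣ n → Coprime p n
  prime∤⇒coprime pp p∤n (d∣p , d∣n) with prime⇒irreducible pp d∣p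
  ... | inj₁ d≡1  = d≡1
  ... | inj₂ refl = contradiction d∣n p∤n

  bézoutℤ : ∀ {m n} → Coprime m n → ∃ λ u → ∃ λ v → u ⊗ + m ⊕ v ⊗ + n ≡ + 1
  bézoutℤ {m} {n} c with coprime-Bézout c
  ... | Bézout.+- x y eq = + x , ⊖ + y , (begin
    + x ⊗ + m ⊕ ⊖ + y ⊗ + n      ≡⟨ cong₂ _⊕_ (sym (ℤ.pos-* x m)) (sym (ℤ.neg-distribˡ-* (+ y) (+ n))) ⟩
    + (x * m) ⊝ + y ⊗ + n        ≡⟨ cong₂ (λ i j → + i ⊝ j) (sym eq) (sym (ℤ.pos-* y n)) ⟩
    + 1 ⊕ + (y * n) ⊝ + (y * n)  ≡⟨ cancel (+ (y * n)) ⟩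
    + 1                          ∎)
    where
    open ≡-Reasoning
    cancel : ∀ i → + 1 ⊕ i ⊝ i ≡ + 1
    cancel = solve-∀
  ... | Bézout.-+ x y eq = ⊖ + x , + y , (begin
    ⊖ + x ⊗ + m ⊕ + y ⊗ + n              ≡⟨ cong₂ _⊕_ (sym (ℤ.neg-distribˡ-* (+ x) (+ m))) (sym (ℤ.pos-* y n)) ⟩
    ⊖ (+ x ⊗ + m) ⊕ + (y * n)            ≡⟨ cong₂ (λ i j → ⊖ i ⊕ + j) (sym (ℤ.pos-* x m)) (sym eq) ⟩
    ⊖ + (x * m) ⊕ (+ 1 ⊕ + (x * m))      ≡⟨ cancel (+ (x * m)) ⟩
    + 1                                  ∎)
    where
    open ≡-Reasoning
    cancel : ∀ i → ⊖ i ⊕ (+ 1 ⊕ i) ≡ + 1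
    cancel = solve-∀

  inverseModPrime : ∀ {p x} → Prime p → ¬ + p ∣ℤ x → ∃ λ u → + p ∣ℤ u ⊗ x ⊝ + 1
  inverseModPrime {p} {x} pp p∤x with bézoutℤ (prime∤⇒coprime pp (λ d → p∤x (∣ᵤ⇒∣ d))) | m∣∣m∣ {x}
  -- Bézout gives an inverse `v` of the absolute value of x; the sign of x enters as the quotient
  -- `q`.
  ... | u , v , eq | ℤ.divides q ∣x∣≡qx = v ⊗ q , ℤ.divides (⊖ u) (begin
    v ⊗ q ⊗ x ⊝ + 1                                ≡⟨ cong₂ _⊝_ (ℤ.*-assoc v q x) (sym eq) ⟩
    v ⊗ (q ⊗ x) ⊝ (u ⊗ + p ⊕ v ⊗ + ℤ.∣ x ∣)        ≡⟨ cong (λ i → v ⊗ i ⊝ (u ⊗ + p ⊕ v ⊗ + ℤ.∣ x ∣)) (sym ∣x∣≡qx) ⟩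
    v ⊗ + ℤ.∣ x ∣ ⊝ (u ⊗ + p ⊕ v ⊗ + ℤ.∣ x ∣)      ≡⟨ cancel u v (+ p) (+ ℤ.∣ x ∣) ⟩
    ⊖ u ⊗ + p                                      ∎)
    where
    open ≡-Reasoning
    cancel : ∀ u v p i → v ⊗ i ⊝ (u ⊗ p ⊕ v ⊗ i) ≡ ⊖ u ⊗ p
    cancel = solve-∀

-- Turns a divisibility claim into one ring identity in which `u` and `v` are the explicit
-- multipliers.
∣-linear : ∀ {i m n k} u v → i ∣ℤ m → i ∣ℤ n → k ≡ u ⊗ m ⊕ v ⊗ n → i ∣ℤ k
∣-linear u v i∣m i∣n k≡ = subst (_ ∣ℤ_) (sym k≡) (∣m∣n⇒∣m+n (∣n⇒∣m*n u i∣m) (∣n⇒∣m*n v i∣n))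

-- (s / x)² ≡ - a modulo p.
root-of-quotient : ∀ {p} → Prime p → ∀ a s x → ¬ + p ∣ℤ x → + p ∣ℤ s ⊗ s ⊕ a ⊗ (x ⊗ x) →
                   ∃ λ r → + p ∣ℤ r ⊗ r ⊕ a
root-of-quotient {p} pp a s x p∤x d with inverseModPrime pp p∤x
... | u , ux≡1 = u ⊗ s , subst (+ p ∣ℤ_) (sym (identity a s x u))
  (∣m∣n⇒∣m-n (∣n⇒∣m*n (u ⊗ u) d) (∣n⇒∣m*n (a ⊗ (u ⊗ x ⊕ + 1)) ux≡1))
  where
  identity : ∀ a s x u → u ⊗ s ⊗ (u ⊗ s) ⊕ a ≡
    u ⊗ u ⊗ (s ⊗ s ⊕ a ⊗ (x ⊗ x)) ⊝ a ⊗ (u ⊗ x ⊕ + 1) ⊗ (u ⊗ x ⊝ + 1)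
  identity = solve-∀

-- Square roots of - a modulo b from local splitting

∣ℤ-norm-binary : ∀ P a β s x y z → P ∣ℤ norm a (β ⊗ P) s x y z → P ∣ℤ s ⊗ s ⊕ a ⊗ (x ⊗ x)
∣ℤ-norm-binary P a β s x y z d =
  ∣-linear (+ 1) (⊖ (β ⊗ (y ⊗ y ⊕ a ⊗ (z ⊗ z)))) d ∣ℤ-refl (identity P a β s x y z)
  where
  identity : ∀ P a β s x y z → s ⊗ s ⊕ a ⊗ (x ⊗ x) ≡
    + 1 ⊗ (s ⊗ s ⊕ a ⊗ (x ⊗ x) ⊕ β ⊗ P ⊗ (y ⊗ y) ⊕ a ⊗ (β ⊗ P) ⊗ (z ⊗ z))
      ⊕ ⊖ (β ⊗ (y ⊗ y ⊕ a ⊗ (z ⊗ z))) ⊗ P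
  identity = solve-∀

-- Once P divides s and x, the part s² + a x² is divisible by P². The coefficient b = β P accounts
-- for only one of the two factors P of the rest, so the other must come from β (y² + a z²).
∣ℤ-norm-multiple : ∀ P a β s x y z .{{_ : ℤ.NonZero P}} →
  P ⊗ P ∣ℤ norm a (β ⊗ P) (s ⊗ P) (x ⊗ P) y z → P ∣ℤ β ⊗ (y ⊗ y ⊕ a ⊗ (z ⊗ z))
∣ℤ-norm-multiple P a β s x y z d = *-cancelʳ-∣ P
  (∣-linear (+ 1) (⊖ (s ⊗ s ⊕ a ⊗ (x ⊗ x))) d ∣ℤ-refl (identity P a β s x y z))
  where
  identity : ∀ P a β s x y z → β ⊗ (y ⊗ y ⊕ a ⊗ (z ⊗ z)) ⊗ P ≡
    + 1 ⊗ (s ⊗ P ⊗ (s ⊗ P) ⊕ a ⊗ (x ⊗ P ⊗ (x ⊗ P)) ⊕ β ⊗ P ⊗ (y ⊗ y) ⊕ a ⊗ (β ⊗ P) ⊗ (z ⊗ z))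
      ⊕ ⊖ (s ⊗ s ⊕ a ⊗ (x ⊗ x)) ⊗ (P ⊗ P)
  identity = solve-∀

norm-homogeneous : ∀ P a b s x y z →
  norm a b (s ⊗ P) (x ⊗ P) (y ⊗ P) (z ⊗ P) ≡ P ⊗ P ⊗ norm a b s x y z
norm-homogeneous = identity
  where
  identity : ∀ P a b s x y z →
    s ⊗ P ⊗ (s ⊗ P) ⊕ a ⊗ (x ⊗ P ⊗ (x ⊗ P)) ⊕ b ⊗ (y ⊗ P ⊗ (y ⊗ P)) ⊕ a ⊗ b ⊗ (z ⊗ P ⊗ (z ⊗ P)) ≡
    P ⊗ P ⊗ (s ⊗ s ⊕ a ⊗ (x ⊗ x) ⊕ b ⊗ (y ⊗ y) ⊕ a ⊗ b ⊗ (z ⊗ z))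
  identity = solve-∀

p∣s²+ax²∧p∣x⇒p∣s : ∀ {p} → Prime p → ∀ a s x → + p ∣ℤ s ⊗ s ⊕ a ⊗ (x ⊗ x) → + p ∣ℤ x → + p ∣ℤ s
p∣s²+ax²∧p∣x⇒p∣s pp a s x d p∣x =
  p∣ℤm⊗m pp s (∣-linear (+ 1) (⊖ (a ⊗ x)) d p∣x (identity a s x))
  where
  identity : ∀ a s x → s ⊗ s ≡ + 1 ⊗ (s ⊗ s ⊕ a ⊗ (x ⊗ x)) ⊕ ⊖ (a ⊗ x) ⊗ x
  identity = solve-∀

-- Either p divides out of all four coordinates, or one of the two binary
-- parts s² + a x² and y² + a z² vanishes nontrivially modulo p.
module _ {p : ℕ} (pp : Prime p) (a β : ℤ) (p∤β : ¬ + p ∣ℤ β) where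

  private
    P = + p
    Root = ∃ λ r → P ∣ℤ r ⊗ r ⊕ a

    instance
      p≢0 : NonZero p
      p≢0 = prime⇒nonZero pp

  -- Dividing all coordinates by p uses up one factor P² and makes the nonzero s strictly smaller.
  -- Hence s factors P² are enough to force the process to stop, and it can only stop at a root.
  descent : ∀ n s x y z → NonZero s → s ≤ n → (P ⊗ P) ℤ.^ n ∣ℤ norm a (β ⊗ P) (+ s) x y z → Root
  descent zero zero x y z () z≤n d
  descent (suc n) s x y z s≢0 s≤n d = by-x (P ∣ℤ? x)
    where
    P²∣N : P ⊗ P ∣ℤ norm a (β ⊗ P) (+ s) x y z
    P²∣N = ∣ℤ-trans (∣m⇒∣m*n ((P ⊗ P) ℤ.^ n) ∣ℤ-refl) d

    P∣s²+ax² : P ∣ℤ + s ⊗ + s ⊕ a ⊗ (x ⊗ x)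
    P∣s²+ax² = ∣ℤ-norm-binary P a β (+ s) x y z (∣ℤ-trans (∣n⇒∣m*n P ∣ℤ-refl) P²∣N)

    by-z : P ∣ℤ x → P ∣ℤ + s → P ∣ℤ y ⊗ y ⊕ a ⊗ (z ⊗ z) → Dec (P ∣ℤ z) → Root
    by-z _ _ d′ (no p∤z) = root-of-quotient pp a y z p∤z d′
    by-z (ℤ.divides x₁ x≡) p∣s d′ (yes p∣z@(ℤ.divides z₁ z≡)) =
      rest (∣⇒∣ᵤ p∣s) (p∣s²+ax²∧p∣x⇒p∣s pp a y z d′ p∣z)
      where
      rest : p ∣ s → P ∣ℤ y → Root
      rest (divides s₁ s≡) (ℤ.divides y₁ y≡) = descent n s₁ x₁ y₁ z₁ s₁≢0 s₁≤n
        (*-cancelˡ-∣ (P ⊗ P) {{ℤ.i*j≢0 P P}} (subst ((P ⊗ P) ℤ.^ suc n ∣ℤ_) N≡ d))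
        where
        s₁≢0 : NonZero s₁
        s₁≢0 = m*n≢0⇒m≢0 s₁ {{subst NonZero s≡ s≢0}}

        s₁≤n : s₁ ≤ n
        s₁≤n = s≤s⁻¹ (≤-trans
          (subst (s₁ <_) (sym s≡) (m<m*n s₁ p {{s₁≢0}} (nonTrivial⇒n>1 p {{prime⇒nonTrivial pp}}))) s≤n)

        N≡ : norm a (β ⊗ P) (+ s) x y z ≡ P ⊗ P ⊗ norm a (β ⊗ P) (+ s₁) x₁ y₁ z₁
        N≡ = begin
          norm a (β ⊗ P) (+ s) x y z                             ≡⟨ cong (λ i → norm a (β ⊗ P) i x y z) (trans (cong +_ s≡) (ℤ.pos-* s₁ p)) ⟩
          norm a (β ⊗ P) (+ s₁ ⊗ P) x y z                        ≡⟨ cong (λ i → norm a (β ⊗ P) (+ s₁ ⊗ P) i y z) x≡ ⟩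
          norm a (β ⊗ P) (+ s₁ ⊗ P) (x₁ ⊗ P) y z                 ≡⟨ cong₂ (norm a (β ⊗ P) (+ s₁ ⊗ P) (x₁ ⊗ P)) y≡ z≡ ⟩
          norm a (β ⊗ P) (+ s₁ ⊗ P) (x₁ ⊗ P) (y₁ ⊗ P) (z₁ ⊗ P)   ≡⟨ norm-homogeneous P a (β ⊗ P) (+ s₁) x₁ y₁ z₁ ⟩
          P ⊗ P ⊗ norm a (β ⊗ P) (+ s₁) x₁ y₁ z₁                 ∎
          where open ≡-Reasoning

    by-x : Dec (P ∣ℤ x) → Root
    by-x (no p∤x) = root-of-quotient pp a (+ s) x p∤x P∣s²+ax²
    by-x (yes p∣x@(ℤ.divides x₁ x≡)) = with-s (∣⇒∣ᵤ p∣s)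
      where
      p∣s : P ∣ℤ + s
      p∣s = p∣s²+ax²∧p∣x⇒p∣s pp a (+ s) x P∣s²+ax² p∣x

      with-s : p ∣ s → Root
      with-s (divides s₁ s≡) = by-z p∣x p∣s
        ([ (λ h → contradiction h p∤β) , id ]′ (p∣ℤm⊗n pp β _
          (∣ℤ-norm-multiple P a β (+ s₁) x₁ y z
            (subst (λ i → P ⊗ P ∣ℤ norm a (β ⊗ P) i (x₁ ⊗ P) y z) (trans (cong +_ s≡) (ℤ.pos-* s₁ p))
              (subst (λ i → P ⊗ P ∣ℤ norm a (β ⊗ P) (+ s) i y z) x≡ P²∣N)))))
        (P ∣ℤ? z)

crt : ∀ {m n} → Coprime m n → ∀ a r₁ r₂ → + m ∣ℤ r₁ ⊗ r₁ ⊕ a → + n ∣ℤ r₂ ⊗ r₂ ⊕ a →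
      ∃ λ r → + (m * n) ∣ℤ r ⊗ r ⊕ a
crt {m} {n} c a r₁ r₂ d₁ d₂ = combine (bézoutℤ c)
  where
  combine : (∃ λ u → ∃ λ v → u ⊗ + m ⊕ v ⊗ + n ≡ + 1) → ∃ λ r → + (m * n) ∣ℤ r ⊗ r ⊕ a
  combine (u , v , eq) = r , glue m∣ n∣
    where
    -- As u m + v n = 1, this is r₁ modulo m and r₂ modulo n.
    r = r₁ ⊗ (v ⊗ + n) ⊕ r₂ ⊗ (u ⊗ + m)

    transfer : ∀ {k} r′ w → + k ∣ℤ r′ ⊗ r′ ⊕ a → r ≡ r′ ⊕ w ⊗ + k → + k ∣ℤ r ⊗ r ⊕ a
    transfer {k} r′ w d r≡ = subst (λ i → + k ∣ℤ i ⊗ i ⊕ a) (sym r≡)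
      (∣-linear (+ 1) (w ⊗ (r′ ⊕ r′ ⊕ w ⊗ + k)) d ∣ℤ-refl (identity a r′ w (+ k)))
      where
      identity : ∀ a r w k → (r ⊕ w ⊗ k) ⊗ (r ⊕ w ⊗ k) ⊕ a ≡ + 1 ⊗ (r ⊗ r ⊕ a) ⊕ w ⊗ (r ⊕ r ⊕ w ⊗ k) ⊗ k
      identity = solve-∀

    1-um : v ⊗ + n ≡ + 1 ⊝ u ⊗ + m
    1-um = trans (cancel (u ⊗ + m) (v ⊗ + n)) (cong (_⊝ u ⊗ + m) eq)
      where
      cancel : ∀ i j → j ≡ i ⊕ j ⊝ i
      cancel = solve-∀

    1-vn : u ⊗ + m ≡ + 1 ⊝ v ⊗ + n
    1-vn = trans (cancel (u ⊗ + m) (v ⊗ + n)) (cong (_⊝ v ⊗ + n) eq)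
      where
      cancel : ∀ i j → i ≡ i ⊕ j ⊝ j
      cancel = solve-∀

    m∣ : + m ∣ℤ r ⊗ r ⊕ a
    m∣ = transfer r₁ ((r₂ ⊝ r₁) ⊗ u) d₁
      (trans (cong (λ i → r₁ ⊗ i ⊕ r₂ ⊗ (u ⊗ + m)) 1-um) (identity r₁ r₂ u (+ m)))
      where
      identity : ∀ r₁ r₂ u m → r₁ ⊗ (+ 1 ⊝ u ⊗ m) ⊕ r₂ ⊗ (u ⊗ m) ≡ r₁ ⊕ (r₂ ⊝ r₁) ⊗ u ⊗ m
      identity = solve-∀

    n∣ : + n ∣ℤ r ⊗ r ⊕ a
    n∣ = transfer r₂ ((r₁ ⊝ r₂) ⊗ v) d₂
      (trans (cong (λ i → r₁ ⊗ (v ⊗ + n) ⊕ r₂ ⊗ i) 1-vn) (identity r₁ r₂ v (+ n)))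
      where
      identity : ∀ r₁ r₂ v n → r₁ ⊗ (v ⊗ n) ⊕ r₂ ⊗ (+ 1 ⊝ v ⊗ n) ≡ r₂ ⊕ (r₁ ⊝ r₂) ⊗ v ⊗ n
      identity = solve-∀

    glue : ∀ {i} → + m ∣ℤ i → + n ∣ℤ i → + (m * n) ∣ℤ i
    glue {i} (ℤ.divides q i≡qm) (ℤ.divides q′ i≡q′n) = ℤ.divides (u ⊗ q′ ⊕ v ⊗ q) (begin
      i                                                ≡⟨ ℤ.*-identityˡ i ⟨
      + 1 ⊗ i                                          ≡⟨ cong (_⊗ i) (sym eq) ⟩
      (u ⊗ + m ⊕ v ⊗ + n) ⊗ i                          ≡⟨ ℤ.*-distribʳ-+ i (u ⊗ + m) (v ⊗ + n) ⟩
      u ⊗ + m ⊗ i ⊕ v ⊗ + n ⊗ i                        ≡⟨ cong₂ (λ j k → u ⊗ + m ⊗ j ⊕ v ⊗ + n ⊗ k) i≡q′n i≡qm ⟩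
      u ⊗ + m ⊗ (q′ ⊗ + n) ⊕ v ⊗ + n ⊗ (q ⊗ + m)       ≡⟨ identity u v q q′ (+ m) (+ n) ⟩
      (u ⊗ q′ ⊕ v ⊗ q) ⊗ (+ m ⊗ + n)                   ≡⟨ cong ((u ⊗ q′ ⊕ v ⊗ q) ⊗_) (ℤ.pos-* m n) ⟨
      (u ⊗ q′ ⊕ v ⊗ q) ⊗ + (m * n)                     ∎)
      where
      open ≡-Reasoning
      identity : ∀ u v q q′ m n → u ⊗ m ⊗ (q′ ⊗ n) ⊕ v ⊗ n ⊗ (q ⊗ m) ≡ (u ⊗ q′ ⊕ v ⊗ q) ⊗ (m ⊗ n)
      identity = solve-∀

pos-^-double : ∀ p n → + (p ^ (n + n)) ≡ (+ p ⊗ + p) ℤ.^ n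
pos-^-double p zero    = refl
pos-^-double p (suc n) = begin
  + (p * p ^ (n + suc n))            ≡⟨ cong (λ k → + (p * p ^ k)) (+-suc n n) ⟩
  + (p * (p * p ^ (n + n)))          ≡⟨ cong +_ (*-assoc p p (p ^ (n + n))) ⟨
  + (p * p * p ^ (n + n))            ≡⟨ ℤ.pos-* (p * p) (p ^ (n + n)) ⟩
  + (p * p) ⊗ + (p ^ (n + n))        ≡⟨ cong₂ _⊗_ (ℤ.pos-* p p) (pos-^-double p n) ⟩
  (+ p ⊗ + p) ⊗ (+ p ⊗ + p) ℤ.^ n    ∎
  where open ≡-Reasoning

-- Since p divides b exactly once, b = β p with β prime to p, and the descent applies. It needs s
-- factors p², so the p-adic zero is taken with precision p^(2s).
splitAt⇒root : ∀ {p a b} → Prime p → p ∣ b → ¬ p * p ∣ b → SplitAt p a b → ∃ λ r → + p ∣ℤ r ⊗ r ⊕ + a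
splitAt⇒root {p} {a} {b} pp (divides β b≡) p²∤b (s , s≢0 , solution) = from (solution (s + s))
  where
  p∤β : ¬ + p ∣ℤ + β
  p∤β p∣β = p²∤b (subst (p * p ∣_) (sym b≡) (*-monoˡ-∣ p (∣⇒∣ᵤ p∣β)))

  from : (∃ λ x → ∃ λ y → ∃ λ z → + (p ^ (s + s)) ∣ℤ norm (+ a) (+ b) (+ s) x y z) →
         ∃ λ r → + p ∣ℤ r ⊗ r ⊕ + a
  from (x , y , z , d) = descent pp (+ a) (+ β) p∤β s s x y z s≢0 ≤-refl
    (subst (λ i → (+ p ⊗ + p) ℤ.^ s ∣ℤ norm (+ a) i (+ s) x y z)
           (trans (cong +_ b≡) (ℤ.pos-* β p))
           (subst (_∣ℤ norm (+ a) (+ b) (+ s) x y z) (pos-^-double p s) d))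

-- Runs through the prime factorisation of b: a repeated prime yields the square factor, and
-- otherwise the roots modulo the distinct primes are glued by the Chinese remainder theorem.
square-factor-or-root : ∀ a b .{{_ : NonZero b}} → (∀ p → Prime p → SplitAt p a b) →
  (∃ λ d → 2 ≤ d × d * d ∣ b) ⊎ (∃ λ r → + b ∣ℤ r ⊗ r ⊕ + a)
square-factor-or-root a b split = subst (λ n → SquareOr n) (sym isFactorisation)
  (over factors factorsPrime (∣-reflexive (sym isFactorisation)))
  where
  open PrimeFactorisation (factorise b)

  SquareOr : ℕ → Set
  SquareOr n = (∃ λ d → 2 ≤ d × d * d ∣ b) ⊎ (∃ λ r → + n ∣ℤ r ⊗ r ⊕ + a)

  over : ∀ ps → All Prime ps → product ps ∣ b → SquareOr (product ps)
  over []       []         _   = inj₂ (+ 0 , ∣ᵤ⇒∣ (divides a (sym (*-identityʳ a))))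
  over (p ∷ ps) (pp ∷ pps) p∣b with over ps pps (∣-trans (n∣m*n p) p∣b)
  ... | inj₁ square   = inj₁ square
  ... | inj₂ (r′ , d) with p * p ∣? b
  ...   | yes p²∣b = inj₁ (p , nonTrivial⇒n>1 p {{prime⇒nonTrivial pp}} , p²∣b)
  ...   | no  p²∤b = inj₂ (combine (splitAt⇒root pp (∣-trans (m∣m*n (product ps)) p∣b) p²∤b (split p pp)))
    where
    combine : (∃ λ r → + p ∣ℤ r ⊗ r ⊕ + a) → ∃ λ r → + (p * product ps) ∣ℤ r ⊗ r ⊕ + a
    -- If p divided the product of the remaining primes, p² would divide b; this gives the
    -- coprimality.
    combine (r , d′) = crt (prime∤⇒coprime pp λ p∣Π → p²∤b (∣-trans (*-monoʳ-∣ p p∣Π) p∣b)) (+ a) r r′ d′ d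

-- Changes of (a, b) that preserve splitting

splitAt-swap : ∀ p a b → SplitAt p a b → SplitAt p b a
splitAt-swap p a b (s , s≢0 , solution) = s , s≢0 , λ k → swap k (solution k)
  where
  identity : ∀ a b s x y z → s ⊗ s ⊕ a ⊗ (x ⊗ x) ⊕ b ⊗ (y ⊗ y) ⊕ a ⊗ b ⊗ (z ⊗ z) ≡
                             s ⊗ s ⊕ b ⊗ (y ⊗ y) ⊕ a ⊗ (x ⊗ x) ⊕ b ⊗ a ⊗ (z ⊗ z)
  identity = solve-∀
  swap : ∀ k → _ → _
  swap k (x , y , z , d) = y , x , z , subst (+ (p ^ k) ∣ℤ_) (identity (+ a) (+ b) (+ s) x y z) d

-- The factor d is absorbed into the coordinates y and z, which leaves the fixed coordinate s
-- unchanged.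
splitAt-/square : ∀ p a b d → SplitAt p a (b * (d * d)) → SplitAt p a b
splitAt-/square p a b d (s , s≢0 , solution) = s , s≢0 , λ k → scale k (solution k)
  where
  D = + d
  identity : ∀ a b d s x y z →
    s ⊗ s ⊕ a ⊗ (x ⊗ x) ⊕ b ⊗ (d ⊗ d) ⊗ (y ⊗ y) ⊕ a ⊗ (b ⊗ (d ⊗ d)) ⊗ (z ⊗ z) ≡
    s ⊗ s ⊕ a ⊗ (x ⊗ x) ⊕ b ⊗ (d ⊗ y ⊗ (d ⊗ y)) ⊕ a ⊗ b ⊗ (d ⊗ z ⊗ (d ⊗ z))
  identity = solve-∀
  cast : + (b * (d * d)) ≡ + b ⊗ (D ⊗ D)
  cast = trans (ℤ.pos-* b (d * d)) (cong (+ b ⊗_) (ℤ.pos-* d d))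
  scale : ∀ k → _ → _
  scale k (x , y , z , h) = x , D ⊗ y , D ⊗ z ,
    subst (+ (p ^ k) ∣ℤ_) (trans (cong (λ i → norm (+ a) i (+ s) x y z) cast)
                                 (identity (+ a) (+ b) D (+ s) x y z)) h

-- Multiply y + z √-a by t + √-a, whose norm is t² + a.
splitAt-step : ∀ p a b b₁ t → NonZero b₁ → t * t + a ≡ b * b₁ → SplitAt p a b → SplitAt p a b₁
splitAt-step p a b b₁ t nz t²+a≡ (s , s≢0 , solution) =
  b₁ * s , m*n≢0 b₁ s {{nz}} {{s≢0}} , λ k → step k (solution k)
  where
  A = + a
  B = + b
  B₁ = + b₁
  U = + t
  S = + s
  cast : U ⊗ U ⊕ A ≡ B ⊗ B₁
  cast = trans (cong (_⊕ A) (sym (ℤ.pos-* t t))) (trans (cong +_ t²+a≡) (ℤ.pos-* b b₁))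
  factor : ∀ a b₁ t s x y z →
    b₁ ⊗ s ⊗ (b₁ ⊗ s) ⊕ a ⊗ (b₁ ⊗ x ⊗ (b₁ ⊗ x)) ⊕ b₁ ⊗ ((t ⊗ y ⊝ a ⊗ z) ⊗ (t ⊗ y ⊝ a ⊗ z))
      ⊕ a ⊗ b₁ ⊗ ((y ⊕ t ⊗ z) ⊗ (y ⊕ t ⊗ z)) ≡
    b₁ ⊗ b₁ ⊗ (s ⊗ s ⊕ a ⊗ (x ⊗ x)) ⊕ b₁ ⊗ (t ⊗ t ⊕ a) ⊗ (y ⊗ y ⊕ a ⊗ (z ⊗ z))
  factor = solve-∀
  unfactor : ∀ a b b₁ s x y z →
    b₁ ⊗ b₁ ⊗ (s ⊗ s ⊕ a ⊗ (x ⊗ x)) ⊕ b₁ ⊗ (b ⊗ b₁) ⊗ (y ⊗ y ⊕ a ⊗ (z ⊗ z)) ≡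
    b₁ ⊗ b₁ ⊗ (s ⊗ s ⊕ a ⊗ (x ⊗ x) ⊕ b ⊗ (y ⊗ y) ⊕ a ⊗ b ⊗ (z ⊗ z))
  unfactor = solve-∀
  step : ∀ k → _ → _
  step k (x , y , z , h) = B₁ ⊗ x , U ⊗ y ⊝ A ⊗ z , y ⊕ U ⊗ z ,
    subst (+ (p ^ k) ∣ℤ_) (sym eq) (∣n⇒∣m*n (B₁ ⊗ B₁) h)
    where
    eq : norm A B₁ (+ (b₁ * s)) (B₁ ⊗ x) (U ⊗ y ⊝ A ⊗ z) (y ⊕ U ⊗ z) ≡ B₁ ⊗ B₁ ⊗ norm A B S x y z
    eq = trans (cong (λ i → norm A B₁ i (B₁ ⊗ x) (U ⊗ y ⊝ A ⊗ z) (y ⊕ U ⊗ z)) (ℤ.pos-* b₁ s))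
        (trans (factor A B₁ U S x y z)
        (trans (cong (λ i → B₁ ⊗ B₁ ⊗ (S ⊗ S ⊕ A ⊗ (x ⊗ x)) ⊕ B₁ ⊗ i ⊗ (y ⊗ y ⊕ A ⊗ (z ⊗ z))) cast)
               (unfactor A B B₁ S x y z)))

-- The algebra (-1, -1) at the prime 2

SquareMod8 : ℤ → Set
SquareMod8 x = ∃ λ (r : Fin 4) → + 8 ∣ℤ x ⊗ x ⊝ + (toℕ r * toℕ r) × (2 ∣ toℕ r → + 2 ∣ℤ x)

-- (r + 4 q)² and r² agree modulo 8, so sums of four squares modulo 8 are settled by a finite check
-- on residues modulo 4. These residues also remember the parity of x.
square-mod-8 : ∀ x → SquareMod8 x
square-mod-8 x = r , 8∣ , even
  where
  q = x ℤ./ℕ 4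
  r = fromℕ< (ℤ.n%ℕd<d x 4)
  R = + toℕ r
  x≡ : x ≡ R ⊕ q ⊗ + 4
  x≡ = trans (ℤ.a≡a%ℕn+[a/ℕn]*n x 4) (cong (λ i → + i ⊕ q ⊗ + 4) (sym (toℕ-fromℕ< (ℤ.n%ℕd<d x 4))))
  identity : ∀ r q → (r ⊕ q ⊗ + 4) ⊗ (r ⊕ q ⊗ + 4) ⊝ r ⊗ r ≡ (q ⊗ r ⊕ + 2 ⊗ (q ⊗ q)) ⊗ + 8
  identity = solve-∀
  8∣ : + 8 ∣ℤ x ⊗ x ⊝ + (toℕ r * toℕ r)
  8∣ = ℤ.divides (q ⊗ R ⊕ + 2 ⊗ (q ⊗ q))
    (trans (cong₂ (λ i j → i ⊗ i ⊝ j) x≡ (ℤ.pos-* (toℕ r) (toℕ r))) (identity R q))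
  even : 2 ∣ toℕ r → + 2 ∣ℤ x
  even 2∣r = subst (+ 2 ∣ℤ_) (sym x≡) (∣m∣n⇒∣m+n (∣ᵤ⇒∣ {+ 2} {R} 2∣r) (∣n⇒∣m*n q (∣ᵤ⇒∣ {+ 2} {+ 4} (divides 2 refl))))

four-squares-mod-8 : ∀ (i j k l : Fin 4) →
  8 ∣ toℕ i * toℕ i + toℕ j * toℕ j + toℕ k * toℕ k + toℕ l * toℕ l → 2 ∣ toℕ i
four-squares-mod-8 = from-yes (all? {n = 4} λ i → all? {n = 4} λ j → all? {n = 4} λ k → all? {n = 4} λ l →
  8 ∣? toℕ i * toℕ i + toℕ j * toℕ j + toℕ k * toℕ k + toℕ l * toℕ l →-dec 2 ∣? toℕ i)

8∣four-squares⇒even : ∀ s x y z → + 8 ∣ℤ norm (+ 1) (+ 1) s x y z → + 2 ∣ℤ s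
8∣four-squares⇒even s x y z d = from (square-mod-8 s) (square-mod-8 x) (square-mod-8 y) (square-mod-8 z)
  where
  identity : ∀ s x y z i j k l → i ⊕ j ⊕ k ⊕ l ≡
    s ⊗ s ⊕ + 1 ⊗ (x ⊗ x) ⊕ + 1 ⊗ (y ⊗ y) ⊕ + 1 ⊗ + 1 ⊗ (z ⊗ z)
      ⊝ (s ⊗ s ⊝ i ⊕ (x ⊗ x ⊝ j) ⊕ (y ⊗ y ⊝ k) ⊕ (z ⊗ z ⊝ l))
  identity = solve-∀
  from : SquareMod8 s → SquareMod8 x → SquareMod8 y → SquareMod8 z → + 2 ∣ℤ s
  from (i , di , even) (j , dj , _) (k , dk , _) (l , dl , _) =
    even (four-squares-mod-8 i j k l (∣⇒∣ᵤ (subst (+ 8 ∣ℤ_)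
      (sym (identity s x y z (+ (toℕ i * toℕ i)) (+ (toℕ j * toℕ j)) (+ (toℕ k * toℕ k)) (+ (toℕ l * toℕ l))))
      (∣m∣n⇒∣m-n d (∣m∣n⇒∣m+n (∣m∣n⇒∣m+n (∣m∣n⇒∣m+n di dj) dk) dl)))))

-- All four coordinates are even and can be halved, which costs a factor 4 and lowers s. The extra
-- factor 2 keeps the sum divisible by 8 at every step; divisibility by 4 would not do, as four odd
-- squares also sum to 0 modulo 4.
four-squares-descent : ∀ n s x y z → NonZero s → s ≤ n →
  ¬ + 2 ⊗ (+ 2 ⊗ + 2) ℤ.^ n ∣ℤ norm (+ 1) (+ 1) (+ s) x y z
four-squares-descent zero zero x y z () z≤n d
-- The parity lemma speaks of the first coordinate only, so each of the other three is swapped into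
-- that place.
four-squares-descent (suc n) s x y z s≢0 s≤n d = rest
  (∣⇒∣ᵤ (8∣four-squares⇒even S x y z 8∣))
  (8∣four-squares⇒even x S y z (subst (+ 8 ∣ℤ_) (swap₁ S x y z) 8∣))
  (8∣four-squares⇒even y x S z (subst (+ 8 ∣ℤ_) (swap₂ S x y z) 8∣))
  (8∣four-squares⇒even z x y S (subst (+ 8 ∣ℤ_) (swap₃ S x y z) 8∣))
  where
  S = + s
  E = + 2 ⊗ (+ 2 ⊗ + 2) ℤ.^ n
  N = norm (+ 1) (+ 1) S x y z

  E≡ : + 2 ⊗ (+ 2 ⊗ + 2) ℤ.^ suc n ≡ + 2 ⊗ + 2 ⊗ E
  E≡ = identity ((+ 2 ⊗ + 2) ℤ.^ n)
    where
    identity : ∀ e → + 2 ⊗ (+ 4 ⊗ e) ≡ + 4 ⊗ (+ 2 ⊗ e)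
    identity = solve-∀

  8∣ : + 8 ∣ℤ N
  8∣ = ∣ℤ-trans (subst (+ 8 ∣ℤ_) (identity ((+ 2 ⊗ + 2) ℤ.^ n)) (∣m⇒∣m*n _ ∣ℤ-refl)) d
    where
    identity : ∀ e → + 8 ⊗ e ≡ + 2 ⊗ (+ 4 ⊗ e)
    identity = solve-∀

  swap₁ : ∀ s x y z → s ⊗ s ⊕ + 1 ⊗ (x ⊗ x) ⊕ + 1 ⊗ (y ⊗ y) ⊕ + 1 ⊗ + 1 ⊗ (z ⊗ z) ≡
                      x ⊗ x ⊕ + 1 ⊗ (s ⊗ s) ⊕ + 1 ⊗ (y ⊗ y) ⊕ + 1 ⊗ + 1 ⊗ (z ⊗ z)
  swap₁ = solve-∀
  swap₂ : ∀ s x y z → s ⊗ s ⊕ + 1 ⊗ (x ⊗ x) ⊕ + 1 ⊗ (y ⊗ y) ⊕ + 1 ⊗ + 1 ⊗ (z ⊗ z) ≡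
                      y ⊗ y ⊕ + 1 ⊗ (x ⊗ x) ⊕ + 1 ⊗ (s ⊗ s) ⊕ + 1 ⊗ + 1 ⊗ (z ⊗ z)
  swap₂ = solve-∀
  swap₃ : ∀ s x y z → s ⊗ s ⊕ + 1 ⊗ (x ⊗ x) ⊕ + 1 ⊗ (y ⊗ y) ⊕ + 1 ⊗ + 1 ⊗ (z ⊗ z) ≡
                      z ⊗ z ⊕ + 1 ⊗ (x ⊗ x) ⊕ + 1 ⊗ (y ⊗ y) ⊕ + 1 ⊗ + 1 ⊗ (s ⊗ s)
  swap₃ = solve-∀

  rest : 2 ∣ s → + 2 ∣ℤ x → + 2 ∣ℤ y → + 2 ∣ℤ z → ⊥
  rest (divides s₁ s≡) (ℤ.divides x₁ x≡) (ℤ.divides y₁ y≡) (ℤ.divides z₁ z≡) =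
    four-squares-descent n s₁ x₁ y₁ z₁ s₁≢0 s₁≤n
      (*-cancelˡ-∣ (+ 2 ⊗ + 2) (subst (_∣ℤ + 2 ⊗ + 2 ⊗ N₁) E≡ (subst (_ ∣ℤ_) N≡ d)))
    where
    N₁ = norm (+ 1) (+ 1) (+ s₁) x₁ y₁ z₁

    s₁≢0 : NonZero s₁
    s₁≢0 = m*n≢0⇒m≢0 s₁ {{subst NonZero s≡ s≢0}}

    s₁≤n : s₁ ≤ n
    s₁≤n = s≤s⁻¹ (≤-trans (subst (s₁ <_) (sym s≡) (m<m*n s₁ 2 {{s₁≢0}} (s≤s (s≤s z≤n)))) s≤n)

    N≡ : N ≡ + 2 ⊗ + 2 ⊗ N₁
    N≡ = begin
      norm (+ 1) (+ 1) S x y z                                              ≡⟨ cong (λ i → norm (+ 1) (+ 1) i x y z) (trans (cong +_ s≡) (ℤ.pos-* s₁ 2)) ⟩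
      norm (+ 1) (+ 1) (+ s₁ ⊗ + 2) x y z                                   ≡⟨ cong (λ i → norm (+ 1) (+ 1) (+ s₁ ⊗ + 2) i y z) x≡ ⟩
      norm (+ 1) (+ 1) (+ s₁ ⊗ + 2) (x₁ ⊗ + 2) y z                          ≡⟨ cong₂ (norm (+ 1) (+ 1) (+ s₁ ⊗ + 2) (x₁ ⊗ + 2)) y≡ z≡ ⟩
      norm (+ 1) (+ 1) (+ s₁ ⊗ + 2) (x₁ ⊗ + 2) (y₁ ⊗ + 2) (z₁ ⊗ + 2)        ≡⟨ norm-homogeneous (+ 2) (+ 1) (+ 1) (+ s₁) x₁ y₁ z₁ ⟩
      + 2 ⊗ + 2 ⊗ N₁                                                        ∎
      where open ≡-Reasoning

¬splitAt-2-1-1 : ¬ SplitAt 2 1 1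
¬splitAt-2-1-1 (s , s≢0 , solution) = from (solution (suc (s + s)))
  where
  from : ¬ (∃ λ x → ∃ λ y → ∃ λ z → + (2 ^ suc (s + s)) ∣ℤ norm (+ 1) (+ 1) (+ s) x y z)
  from (x , y , z , d) = four-squares-descent s s x y z s≢0 ≤-refl
    (subst (_∣ℤ norm (+ 1) (+ 1) (+ s) x y z)
      (trans (ℤ.pos-* 2 (2 ^ (s + s))) (cong (+ 2 ⊗_) (pos-^-double 2 s))) d)

-- Legendre's descent

least-root : ∀ {b} .{{_ : NonZero b}} a r → + b ∣ℤ r ⊗ r ⊕ + a → ∃ λ t → t + t ≤ b × b ∣ t * t + a
least-root {b} a r d = choose (≤-total (t₀ + t₀) b)
  where
  t₀ = r ℤ.%ℕ b
  q = r ℤ./ℕ b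
  B = + b

  t₀≤b : t₀ ≤ b
  t₀≤b = <⇒≤ (ℤ.n%ℕd<d r b)

  cast : ∀ t → + (t * t + a) ≡ + t ⊗ + t ⊕ + a
  cast t = cong (_⊕ + a) (ℤ.pos-* t t)

  root₀ : b ∣ t₀ * t₀ + a
  root₀ = ∣⇒∣ᵤ (∣-linear (+ 1) (⊖ (+ t₀ ⊕ + t₀ ⊕ q ⊗ B) ⊗ q)
    (subst (λ i → B ∣ℤ i ⊗ i ⊕ + a) (ℤ.a≡a%ℕn+[a/ℕn]*n r b) d) ∣ℤ-refl
    (trans (cast t₀) (identity (+ a) (+ t₀) q B)))
    where
    identity : ∀ a t q b → t ⊗ t ⊕ a ≡
      + 1 ⊗ ((t ⊕ q ⊗ b) ⊗ (t ⊕ q ⊗ b) ⊕ a) ⊕ ⊖ (t ⊕ t ⊕ q ⊗ b) ⊗ q ⊗ b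
    identity = solve-∀

  -- The opposite root: one of t₀ and b - t₀ is at most b / 2.
  t₁ = b ∸ t₀

  b≡ : t₁ + t₀ ≡ b
  b≡ = m∸n+n≡m t₀≤b

  root₁ : b ∣ t₁ * t₁ + a
  root₁ = ∣⇒∣ᵤ (∣-linear (+ 1) (+ t₁ ⊝ + t₀) (∣ᵤ⇒∣ {+ b} {+ (t₀ * t₀ + a)} root₀) ∣ℤ-refl
    (trans (cast t₁) (trans (identity (+ a) (+ t₁) (+ t₀))
      (cong₂ (λ i j → + 1 ⊗ i ⊕ (+ t₁ ⊝ + t₀) ⊗ + j) (sym (cast t₀)) b≡))))
    where
    identity : ∀ a t s → t ⊗ t ⊕ a ≡ + 1 ⊗ (s ⊗ s ⊕ a) ⊕ (t ⊝ s) ⊗ (t ⊕ s)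
    identity = solve-∀

  t₁+t₁≤b : b ≤ t₀ + t₀ → t₁ + t₁ ≤ b
  t₁+t₁≤b b≤ = ≤-trans (+-monoʳ-≤ t₁ (+-cancelʳ-≤ t₀ t₁ t₀ (≤-trans (≤-reflexive b≡) b≤))) (≤-reflexive b≡)

  choose : t₀ + t₀ ≤ b ⊎ b ≤ t₀ + t₀ → ∃ λ t → t + t ≤ b × b ∣ t * t + a
  choose (inj₁ le) = t₀ , le , root₀
  choose (inj₂ ge) = t₁ , t₁+t₁≤b ge , root₁

-- t² + a ≤ b² / 4 + b < b² for 2 ≤ b.
cofactor-< : ∀ a b b₁ t → 2 ≤ b → a ≤ b → t + t ≤ b → t * t + a ≡ b₁ * b → b₁ < b
cofactor-< a b b₁ t 2≤b a≤b 2t≤b eq = ≰⇒> λ b≤b₁ → <-irrefl refl (begin-strict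
  4 * (b * b)                          ≤⟨ *-monoʳ-≤ 4 (*-monoˡ-≤ b b≤b₁) ⟩
  4 * (b₁ * b)                         ≡⟨ cong (4 *_) eq ⟨
  4 * (t * t + a)                      ≡⟨ expand t a ⟩
  (t + t) * (t + t) + 4 * a            ≤⟨ +-mono-≤ (*-mono-≤ 2t≤b 2t≤b) (*-monoʳ-≤ 4 a≤b) ⟩
  b * b + 4 * b                        ≤⟨ +-monoʳ-≤ (b * b) (≤-trans (≤-reflexive (double b)) (*-monoʳ-≤ 2 (*-monoˡ-≤ b 2≤b))) ⟩
  b * b + 2 * (b * b)                  <⟨ m<m+n _ (*-mono-≤ b≥1 b≥1) ⟩
  b * b + 2 * (b * b) + b * b          ≡⟨ collect (b * b) ⟩
  4 * (b * b)                          ∎)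
  where
  open ≤-Reasoning
  b≥1 : 1 ≤ b
  b≥1 = ≤-trans (s≤s z≤n) 2≤b
  expand : ∀ t a → 4 * (t * t + a) ≡ (t + t) * (t + t) + 4 * a
  expand = ℕ-Solver.solve-∀
  double : ∀ b → 4 * b ≡ 2 * (2 * b)
  double = ℕ-Solver.solve-∀
  collect : ∀ c → c + 2 * c + c ≡ 4 * c
  collect = ℕ-Solver.solve-∀

-- Induction on a bound n for a + b. The symmetry of the algebra puts the larger entry second, and
-- `¬split-everywhere-≤` then makes that entry smaller.
¬split-everywhere : ∀ n a b → NonZero a → NonZero b → a + b ≤ n → ¬ (∀ p → Prime p → SplitAt p a b)

¬split-everywhere-≤ : ∀ n a b → NonZero a → NonZero b → a ≤ b → a + b ≤ n → ¬ (∀ p → Prime p → SplitAt p a b)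
¬split-everywhere-≤ zero    (suc _) _ _ _ _ () split
¬split-everywhere-≤ (suc n) a 1 a≢0 _ a≤1 _ split =
  ¬splitAt-2-1-1 (subst (λ i → SplitAt 2 i 1) (≤-antisym a≤1 (>-nonZero⁻¹ a {{a≢0}})) (split 2 prime[2]))
¬split-everywhere-≤ (suc n) a b@(suc (suc _)) a≢0 b≢0 a≤b a+b≤n split
  with square-factor-or-root a b split
... | inj₁ (d , 2≤d , divides q b≡) = ¬split-everywhere n a q a≢0 q≢0
        (s≤s⁻¹ (≤-trans (+-monoʳ-< a q<b) a+b≤n))
        (λ p pp → splitAt-/square p a q d (subst (SplitAt p a) b≡ (split p pp)))
  where
  q≢0 : NonZero q
  q≢0 = m*n≢0⇒m≢0 q {{subst NonZero b≡ b≢0}}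

  q<b : q < b
  q<b = subst (q <_) (sym b≡) (m<m*n q (d * d) {{q≢0}} (≤-trans 2≤d (m≤m*n d d {{>-nonZero (≤-trans (s≤s z≤n) 2≤d)}})))
... | inj₂ (r , b∣r²+a) = descend (least-root a r b∣r²+a)
  where
  descend : (∃ λ t → t + t ≤ b × b ∣ t * t + a) → ⊥
  descend (t , 2t≤b , divides b₁ eq) = ¬split-everywhere n a b₁ a≢0 b₁≢0
    (s≤s⁻¹ (≤-trans (+-monoʳ-< a (cofactor-< a b b₁ t (s≤s (s≤s z≤n)) a≤b 2t≤b eq)) a+b≤n))
    (λ p pp → splitAt-step p a b b₁ t b₁≢0 (trans eq (*-comm b₁ b)) (split p pp))
    where
    -- Definiteness is used here: t² + a is positive because a is, so its cofactor cannot vanish.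
    b₁≢0 : NonZero b₁
    b₁≢0 = m*n≢0⇒m≢0 b₁ {{subst NonZero eq (>-nonZero (≤-trans (>-nonZero⁻¹ a {{a≢0}}) (m≤n+m a (t * t))))}}

¬split-everywhere n a b a≢0 b≢0 a+b≤n split with ≤-total a b
... | inj₁ a≤b = ¬split-everywhere-≤ n a b a≢0 b≢0 a≤b a+b≤n split
... | inj₂ b≤a = ¬split-everywhere-≤ n b a b≢0 a≢0 b≤a (≤-trans (≤-reflexive (+-comm b a)) a+b≤n)
                   (λ p pp → splitAt-swap p a b (split p pp))

-- Splitting at 2

Odd : ℕ → Set
Odd n = ∃ λ h → n ≡ suc (2 * h)

even-or-odd : ∀ q → (∃ λ q′ → q ≡ 2 * q′) ⊎ Odd q
even-or-odd zero = inj₁ (0 , refl)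
even-or-odd (suc q) with even-or-odd q
... | inj₁ (q′ , refl) = inj₂ (q′ , refl)
... | inj₂ (q′ , refl) = inj₁ (suc q′ , sym (*-suc 2 q′))

-- Hensel lifting at 2, one binary digit at a time, from the solution x = 1 modulo 8. Here x = 2 y +
-- 1 stays odd throughout.
odd-square-lift : ∀ m h → 8 ∣ m + suc (2 * h) →
  ∀ j → ∃ λ y → 8 * 2 ^ j ∣ m + suc (2 * h) * (suc (2 * y) * suc (2 * y))
odd-square-lift m h d zero    = 0 , subst (λ i → 8 ∣ m + i) (sym (*-identityʳ (suc (2 * h)))) d
odd-square-lift m h d (suc j) with odd-square-lift m h d j
... | y , divides q eq = lift (even-or-odd q)
  where
  e = 2 ^ j
  even-identity : ∀ q e → 2 * q * (8 * e) ≡ q * (8 * (2 * e))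
  even-identity = ℕ-Solver.solve-∀
  expand : ∀ m h y e → m + (1 + 2 * h) * ((1 + 2 * (y + 2 * e)) * (1 + 2 * (y + 2 * e))) ≡
    m + (1 + 2 * h) * ((1 + 2 * y) * (1 + 2 * y)) + 8 * e * ((1 + 2 * h) * (1 + 2 * y) + 2 * e * (1 + 2 * h))
  expand = ℕ-Solver.solve-∀
  odd-identity : ∀ q h y e → (1 + 2 * q) * (8 * e) + 8 * e * ((1 + 2 * h) * (1 + 2 * y) + 2 * e * (1 + 2 * h)) ≡
    (1 + q + h + y + 2 * (h * y) + e * (1 + 2 * h)) * (8 * (2 * e))
  odd-identity = ℕ-Solver.solve-∀
  lift : (∃ λ q′ → q ≡ 2 * q′) ⊎ Odd q →
    ∃ λ y → 8 * (2 * e) ∣ m + suc (2 * h) * (suc (2 * y) * suc (2 * y))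
  lift (inj₁ (q′ , q≡)) = y , divides q′ (trans eq (trans (cong (_* (8 * e)) q≡) (even-identity q′ e)))
  -- Adding 4 e to x changes the value by an odd multiple of 8 e, which turns the odd quotient q
  -- into an even one.
  lift (inj₂ (q′ , q≡)) = y + 2 * e , divides (1 + q′ + h + y + 2 * (h * y) + e * (1 + 2 * h)) (trans (expand m h y e)
    (trans (cong (_+ 8 * e * (suc (2 * h) * suc (2 * y) + 2 * e * suc (2 * h)))
                 (trans eq (cong (_* (8 * e)) q≡)))
           (odd-identity q′ h y e)))

norm-pos : ∀ a b s x y z → norm (+ a) (+ b) (+ s) (+ x) (+ y) (+ z) ≡
  + (s * s + a * (x * x) + b * (y * y) + a * b * (z * z))
norm-pos a b s x y z = cong₂ _⊕_ (cong₂ _⊕_ (cong₂ _⊕_ (sym (ℤ.pos-* s s)) (square a x)) (square b y))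
  (trans (cong (_⊗ (+ z ⊗ + z)) (sym (ℤ.pos-* a b))) (square (a * b) z))
  where
  square : ∀ a x → + a ⊗ (+ x ⊗ + x) ≡ + (a * (x * x))
  square a x = trans (cong (+ a ⊗_) (sym (ℤ.pos-* x x))) (sym (ℤ.pos-* a (x * x)))

-- For odd a the values a x² with x odd fill a + 8ℤ₂, so x need only be found modulo 8.
splitAt-2-from-mod-8 : ∀ h b y z → 8 ∣ 1 + b * (y * y) + suc (2 * h) * b * (z * z) + suc (2 * h) →
  SplitAt 2 (suc (2 * h)) b
splitAt-2-from-mod-8 h b y z d = 1 , _ , λ k → solution k (odd-square-lift m h d k)
  where
  a = suc (2 * h)
  m = 1 + b * (y * y) + a * b * (z * z)
  rearrange : ∀ a b x y z → 1 + b * y + a * b * z + a * x ≡ 1 + a * x + b * y + a * b * z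
  rearrange = ℕ-Solver.solve-∀
  solution : ∀ k → (∃ λ x → 8 * 2 ^ k ∣ m + a * (suc (2 * x) * suc (2 * x))) →
    ∃ λ x → ∃ λ y → ∃ λ z → + (2 ^ k) ∣ℤ norm (+ a) (+ b) (+ 1) x y z
  solution k (x₀ , d′) = + x , + y , + z , subst (+ (2 ^ k) ∣ℤ_) (sym (norm-pos a b 1 x y z))
    (∣ᵤ⇒∣ {+ (2 ^ k)} {+ (1 + a * (x * x) + b * (y * y) + a * b * (z * z))}
      (subst (2 ^ k ∣_) (rearrange a b (x * x) (y * y) (z * z)) (∣-trans (n∣m*n 8) d′)))
    where x = suc (2 * x₀)

-- Take s = x = 1 modulo 8. If a ≡ 7, then 1 + a ≡ 0 and y = z = 0 will do. If a ≡ 3, take y = z =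
-- 1: the norm is (1 + a)(1 + b), with 4 dividing the first factor and 2 the second.
splitAt-2 : ∀ i h → SplitAt 2 (3 + 4 * i) (suc (2 * h))
splitAt-2 i h = subst (λ a → SplitAt 2 a b) (sym (a≡ i)) (by-parity i)
  where
  b = suc (2 * h)
  a≡ : ∀ i → 3 + 4 * i ≡ 1 + 2 * (1 + 2 * i)
  a≡ = ℕ-Solver.solve-∀
  three : ∀ j b → 1 + b * 1 + (1 + 2 * (1 + 2 * (2 * j))) * b * 1 + (1 + 2 * (1 + 2 * (2 * j))) ≡ 4 * (1 + 2 * j) * (1 + b)
  three = ℕ-Solver.solve-∀
  twice : ∀ j h → 4 * (1 + 2 * j) * (1 + (1 + 2 * h)) ≡ (1 + 2 * j) * (1 + h) * 8
  twice = ℕ-Solver.solve-∀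
  seven : ∀ j b → 1 + b * 0 + (1 + 2 * (1 + 2 * (1 + 2 * j))) * b * 0 + (1 + 2 * (1 + 2 * (1 + 2 * j))) ≡ (1 + j) * 8
  seven = ℕ-Solver.solve-∀
  by-parity : ∀ i → SplitAt 2 (1 + 2 * (1 + 2 * i)) b
  by-parity i with even-or-odd i
  ... | inj₁ (j , refl) = splitAt-2-from-mod-8 (1 + 2 * (2 * j)) b 1 1 (divides ((1 + 2 * j) * (1 + h)) (trans (three j b) (twice j h)))
  ... | inj₂ (j , refl) = splitAt-2-from-mod-8 (1 + 2 * (1 + 2 * j)) b 0 0 (divides (1 + j) (seven j b))

-- Density

card-++ : ∀ {m n} (S : Subset m) (S′ : Subset n) → card (S ++ S′) ≡ card S + card S′
card-++ []          S′ = refl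
card-++ (true  ∷ S) S′ = cong suc (card-++ S S′)
card-++ (false ∷ S) S′ = card-++ S S′

∉⇒card< : ∀ {n} {S : Subset n} {i} → i ∉ S → card S < n
∉⇒card< {n} {S} i∉S = subst (card S <_) (∣⊤∣≡n n) (p⊂q⇒∣p∣<∣q∣ ((λ _ → ∈⊤) , _ , ∈⊤ , i∉S))

-- Cut the range into k blocks of length m. Each block misses at least its element in position j, so
-- at least k elements are lost.
card-avoiding : (Q : Pred ℕ 0ℓ) (m j : ℕ) → j < m → Q j → (∀ i → Q i → Q (m + i)) →
  ∀ k (S : Subset (k * m)) → (∀ i → Q (toℕ i) → i ∉ S) → card S + k ≤ k * m
card-avoiding Q m j j<m Qj period zero    [] avoid = z≤n
card-avoiding Q m j j<m Qj period (suc k) S  avoid with splitAt m S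
... | S₁ , S₂ , refl = begin
  card (S₁ ++ S₂) + suc k         ≡⟨ cong (_+ suc k) (card-++ S₁ S₂) ⟩
  card S₁ + card S₂ + suc k       ≡⟨ +-suc (card S₁ + card S₂) k ⟩
  suc (card S₁ + card S₂ + k)     ≡⟨ cong suc (+-assoc (card S₁) (card S₂) k) ⟩
  suc (card S₁) + (card S₂ + k)   ≤⟨ +-mono-≤ (∉⇒card< j∉S₁) (card-avoiding Q m j j<m Qj period k S₂ avoid₂) ⟩
  m + k * m                       ∎
  where
  open ≤-Reasoning
  i₀ : Fin m
  i₀ = fromℕ< j<m

  j∉S₁ : i₀ ∉ S₁
  j∉S₁ i₀∈S₁ = avoid (i₀ ↑ˡ (k * m))
    (subst Q (sym (trans (toℕ-↑ˡ i₀ (k * m)) (toℕ-fromℕ< j<m))) Qj)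
    (lookup⇒[]= _ (S₁ ++ S₂) (trans (lookup-++ˡ S₁ S₂ i₀) ([]=⇒lookup i₀∈S₁)))

  avoid₂ : ∀ i → Q (toℕ i) → i ∉ S₂
  avoid₂ i Qi i∈S₂ = avoid (m ↑ʳ i) (subst Q (sym (toℕ-↑ʳ m i)) (period _ Qi))
    (lookup⇒[]= _ (S₁ ++ S₂) (trans (lookup-++ʳ S₁ S₂ i) ([]=⇒lookup i∈S₂)))

-- The cross-multiplied form of 1/m ≤ |c/n - 1|, shaped as the order on unnormalised rationals
-- unfolds.
1*n≤∣c-n∣*m : ∀ {c k m n} → c + k ≤ n → n ≡ k * m →
  + 1 ⊗ + (n * 1) ℤ.≤ + ℤ.∣ + c ⊗ + 1 ⊕ ⊖ + 1 ⊗ + n ∣ ⊗ + m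
1*n≤∣c-n∣*m {c} {k} {m} {n} c+k≤n n≡km = begin
  + 1 ⊗ + (n * 1)                                        ≡⟨ trans (ℤ.*-identityˡ (+ (n * 1))) (cong +_ (*-identityʳ n)) ⟩
  + n                                                      ≡⟨ cong +_ n≡km ⟩
  + (k * m)                                                ≤⟨ ℤ.+≤+ (*-monoˡ-≤ m k≤n-c) ⟩
  + ((n ∸ c) * m)                                          ≡⟨ ℤ.pos-* (n ∸ c) m ⟩
  + (n ∸ c) ⊗ + m                                        ≡⟨ cong (λ i → + i ⊗ + m) numerator ⟨
  + ℤ.∣ + c ⊗ + 1 ⊕ ⊖ + 1 ⊗ + n ∣ ⊗ + m          ∎
  where
  open ℤ.≤-Reasoning
  numerator : ℤ.∣ + c ⊗ + 1 ⊕ ⊖ + 1 ⊗ + n ∣ ≡ n ∸ c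
  numerator = trans
    (cong₂ (λ i j → ℤ.∣ i ⊕ j ∣) (ℤ.*-identityʳ (+ c)) (ℤ.-1*i≡-i (+ n)))
    (trans (cong ℤ.∣_∣ (ℤ.m-n≡m⊖n c (n))) (ℤ.∣⊖∣-≤ (≤-trans (m≤m+n c k) c+k≤n)))

  k≤n-c : k ≤ n ∸ c
  k≤n-c = m+n≤o⇒m≤o∸n k (≤-trans (≤-reflexive (+-comm k c)) c+k≤n)

∣c/n-1∣≥1/m : ∀ {c k m n} → c + k ≤ suc n → suc n ≡ k * suc m →
  + 1 ℚ./ suc m ℚ.≤ ℚ.∣ + c ℚ./ suc n ℚ.- 1ℚ ∣
∣c/n-1∣≥1/m {c} {k} {m} {n} c+k≤n n≡km = ℚ.toℚᵘ-cancel-≤ (begin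
  toℚᵘ (+ 1 ℚ./ suc m)                       ≃⟨ ℚ.toℚᵘ-fromℚᵘ (mkℚᵘ (+ 1) m) ⟩
  mkℚᵘ (+ 1) m                               ≤⟨ *≤* (1*n≤∣c-n∣*m {c} {k} {suc m} {suc n} c+k≤n n≡km) ⟩
  ℚᵘ.∣ mkℚᵘ (+ c) n ℚᵘ.- ℚᵘ.1ℚᵘ ∣            ≃⟨ ℚᵘ.∣-∣-cong (ℚᵘ.+-congˡ (ℚᵘ.- ℚᵘ.1ℚᵘ) (ℚ.toℚᵘ-fromℚᵘ (mkℚᵘ (+ c) n))) ⟨
  ℚᵘ.∣ toℚᵘ (+ c ℚ./ suc n) ℚᵘ.- ℚᵘ.1ℚᵘ ∣    ≃⟨ ℚᵘ.∣-∣-cong (ℚ.toℚᵘ-homo-+ (+ c ℚ./ suc n) (ℚ.- 1ℚ)) ⟨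
  ℚᵘ.∣ toℚᵘ (+ c ℚ./ suc n ℚ.- 1ℚ) ∣         ≃⟨ ℚ.toℚᵘ-homo-∣-∣ (+ c ℚ./ suc n ℚ.- 1ℚ) ⟨
  toℚᵘ ℚ.∣ + c ℚ./ suc n ℚ.- 1ℚ ∣            ∎)
  where
  open ℚᵘ.≤-Reasoning

-- A class modulo m that is never met leaves a gap in each block of m integers, which keeps the
-- proportion at distance at least 1/m from 1. The class is prescribed for n while n + 1 is
-- represented, as index i of a counted subset stands for i + 1.
represents-every-class : ∀ {f} → AsymptoticallyUniversal f → ∀ m .{{_ : NonZero m}} j →
  ∃ λ n → n % m ≡ j % m × Represents f (suc n)
represents-every-class {f} (count , counts , limit) m@(suc m-1) j = found (any? λ i → (i ∈? S) ×-dec (toℕ i % m ≟ j % m))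
  where
  ε = + 1 ℚ./ m
  N₀ = proj₁ (limit ε (ℚ.positive⁻¹ ε {{ℚ.normalize-pos 1 m}}))
  -- A multiple of m, so that the blocks fit exactly. The proportion for N is the term of index
  -- `pred N` in the sequence, whence `suc N₀`.
  N = suc N₀ * m
  counted = counts N
  S = proj₁ counted

  N≥ : N₀ ≤ pred N
  N≥ = s≤s⁻¹ (m≤m*n (suc N₀) m)

  found : Dec (∃ λ i → i ∈ S × toℕ i % m ≡ j % m) → ∃ λ n → n % m ≡ j % m × Represents f (suc n)
  found (yes (i , i∈S , i≡j)) = toℕ i , i≡j , Equivalence.to (proj₁ (proj₂ counted) i) i∈S
  found (no none) = contradiction
    (ℚ.<-≤-trans (proj₂ (limit ε (ℚ.positive⁻¹ ε {{ℚ.normalize-pos 1 m}})) (pred N) N≥)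
                 (∣c/n-1∣≥1/m {count N} {suc N₀} {m-1} {pred N} sparse refl))
    (ℚ.<-irrefl refl)
    where
    sparse : count N + suc N₀ ≤ N
    sparse = subst (λ c → c + suc N₀ ≤ N) (proj₂ (proj₂ counted))
      (card-avoiding (λ n → n % m ≡ j % m) m (j % m) (m%n<n j m) (m%n%n≡m%n j m)
        (λ n n≡j → trans (cong (_% m) (+-comm m n)) (trans ([m+n]%n≡m%n n m) n≡j))
        (suc N₀) S (λ i i≡j i∈S → none (i , i∈S , i≡j)))

-- Splitting at odd primes

even-z⊗z+1 : ∀ z → + 2 ∣ℤ z ⊗ (z ⊕ + 1)
even-z⊗z+1 z = from (z ℤ.%ℕ 2) (ℤ.n%ℕd<d z 2) (ℤ.a≡a%ℕn+[a/ℕn]*n z 2)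
  where
  q = z ℤ./ℕ 2
  zero-identity : ∀ q → (+ 0 ⊕ q ⊗ + 2) ⊗ (+ 0 ⊕ q ⊗ + 2 ⊕ + 1) ≡ q ⊗ (q ⊗ + 2 ⊕ + 1) ⊗ + 2
  zero-identity = solve-∀
  one-identity : ∀ q → (+ 1 ⊕ q ⊗ + 2) ⊗ (+ 1 ⊕ q ⊗ + 2 ⊕ + 1) ≡ (+ 1 ⊕ q ⊗ + 2) ⊗ (q ⊕ + 1) ⊗ + 2
  one-identity = solve-∀
  from : ∀ r → r < 2 → z ≡ + r ⊕ q ⊗ + 2 → + 2 ∣ℤ z ⊗ (z ⊕ + 1)
  from 0 _ z≡ = ℤ.divides (q ⊗ (q ⊗ + 2 ⊕ + 1))
    (trans (cong (λ i → i ⊗ (i ⊕ + 1)) z≡) (zero-identity q))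
  from 1 _ z≡ = ℤ.divides ((+ 1 ⊕ q ⊗ + 2) ⊗ (q ⊕ + 1))
    (trans (cong (λ i → i ⊗ (i ⊕ + 1)) z≡) (one-identity q))
  from (suc (suc _)) (s≤s (s≤s ())) _

-- `T` is defined by division with remainder; the remainder is 0 because z (z + 1) is even.
T-double : ∀ z → z ⊗ (z ⊕ + 1) ≡ T z ⊗ + 2
T-double z = from (n ℤ.% + 2) (ℤ.n%d<d n (+ 2)) (ℤ.a≡a%n+[a/n]*n n (+ 2))
  where
  n = z ⊗ (z ⊕ + 1)
  identity : ∀ r t → r ≡ + 1 ⊗ (r ⊕ t ⊗ + 2) ⊕ ⊖ t ⊗ + 2
  identity = solve-∀
  from : ∀ r → r < 2 → n ≡ + r ⊕ T z ⊗ + 2 → n ≡ T z ⊗ + 2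
  from 0 _ n≡ = trans n≡ (ℤ.+-identityˡ (T z ⊗ + 2))
  from 1 _ n≡ = contradiction
    (∣⇒∣ᵤ {+ 2} {+ 1} (∣-linear (+ 1) (⊖ T z) (subst (+ 2 ∣ℤ_) n≡ (even-z⊗z+1 z)) ∣ℤ-refl (identity (+ 1) (T z))))
    (from-no (2 ∣? 1))
  from (suc (suc _)) (s≤s (s≤s ())) _

form-completed : ∀ a b c x y z →
  + 8 ⊗ form a b c x y z ⊕ + c ≡
  + (8 * a) ⊗ (x ⊗ x) ⊕ + (8 * b) ⊗ (y ⊗ y) ⊕ + c ⊗ ((z ⊕ z ⊕ + 1) ⊗ (z ⊕ z ⊕ + 1))
form-completed a b c x y z = begin
  + 8 ⊗ (A ⊗ (x ⊗ (x ⊗ + 1)) ⊕ B ⊗ (y ⊗ (y ⊗ + 1)) ⊕ C ⊗ T z) ⊕ C                       ≡⟨ expand A B C x y (T z) ⟩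
  + 8 ⊗ A ⊗ (x ⊗ x) ⊕ + 8 ⊗ B ⊗ (y ⊗ y) ⊕ C ⊗ (+ 4 ⊗ (T z ⊗ + 2) ⊕ + 1)                 ≡⟨ cong (λ i → + 8 ⊗ A ⊗ (x ⊗ x) ⊕ + 8 ⊗ B ⊗ (y ⊗ y) ⊕ C ⊗ (+ 4 ⊗ i ⊕ + 1)) (T-double z) ⟨
  + 8 ⊗ A ⊗ (x ⊗ x) ⊕ + 8 ⊗ B ⊗ (y ⊗ y) ⊕ C ⊗ (+ 4 ⊗ (z ⊗ (z ⊕ + 1)) ⊕ + 1)             ≡⟨ cong₂ _⊕_ (cong₂ _⊕_ (cong (_⊗ (x ⊗ x)) (ℤ.pos-* 8 a)) (cong (_⊗ (y ⊗ y)) (ℤ.pos-* 8 b))) (cong (C ⊗_) (complete z)) ⟨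
  + (8 * a) ⊗ (x ⊗ x) ⊕ + (8 * b) ⊗ (y ⊗ y) ⊕ C ⊗ ((z ⊕ z ⊕ + 1) ⊗ (z ⊕ z ⊕ + 1))       ∎
  where
  open ≡-Reasoning
  A = + a
  B = + b
  C = + c
  expand : ∀ a b c x y t → + 8 ⊗ (a ⊗ (x ⊗ (x ⊗ + 1)) ⊕ b ⊗ (y ⊗ (y ⊗ + 1)) ⊕ c ⊗ t) ⊕ c ≡
    + 8 ⊗ a ⊗ (x ⊗ x) ⊕ + 8 ⊗ b ⊗ (y ⊗ y) ⊕ c ⊗ (+ 4 ⊗ (t ⊗ + 2) ⊕ + 1)
  expand = solve-∀
  complete : ∀ z → (z ⊕ z ⊕ + 1) ⊗ (z ⊕ z ⊕ + 1) ≡ + 4 ⊗ (z ⊗ (z ⊕ + 1)) ⊕ + 1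
  complete = solve-∀

%≡⇒∣⊝ : ∀ m n o .{{_ : NonZero o}} → m % o ≡ n % o → + o ∣ℤ + m ⊝ + n
%≡⇒∣⊝ m n o eq = ℤ.divides (+ (m / o) ⊝ + (n / o)) (begin
  + m ⊝ + n                                                    ≡⟨ cong₂ _⊝_ (cast m) (cast n) ⟩
  (+ (m % o) ⊕ + (m / o) ⊗ + o) ⊝ (+ (n % o) ⊕ + (n / o) ⊗ + o)  ≡⟨ cong (λ r → (+ r ⊕ + (m / o) ⊗ + o) ⊝ (+ (n % o) ⊕ + (n / o) ⊗ + o)) eq ⟩
  (+ (n % o) ⊕ + (m / o) ⊗ + o) ⊝ (+ (n % o) ⊕ + (n / o) ⊗ + o)  ≡⟨ identity (+ (n % o)) (+ (m / o)) (+ (n / o)) (+ o) ⟩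
  (+ (m / o) ⊝ + (n / o)) ⊗ + o                                ∎)
  where
  open ≡-Reasoning
  cast : ∀ m → + m ≡ + (m % o) ⊕ + (m / o) ⊗ + o
  cast m = trans (cong +_ (m≡m%n+[m/n]*n m o)) (cong (+ (m % o) ⊕_) (ℤ.pos-* (m / o) o))
  identity : ∀ r p q o → (r ⊕ p ⊗ o) ⊝ (r ⊕ q ⊗ o) ≡ (p ⊝ q) ⊗ o
  identity = solve-∀

-- h is minus the inverse of 2 modulo 2h + 1, so j = h³(8 + w) solves 8(j + 1) + w ≡ 0.
8n+8+w≡0 : ∀ h w n → n % suc (2 * h) ≡ (h * h * h * (8 + w)) % suc (2 * h) →
  + suc (2 * h) ∣ℤ + 8 ⊗ + suc n ⊕ + w
8n+8+w≡0 h w n n≡j = ∣-linear (+ 8) ((+ 8 ⊕ + w) ⊗ (+ 4 ⊗ H ⊗ H ⊝ + 2 ⊗ H ⊕ + 1))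
  (%≡⇒∣⊝ n (h * h * h * (8 + w)) (suc (2 * h)) n≡j) ∣ℤ-refl
  (trans (identity H (+ w) (+ n))
    (cong₂ (λ j m → + 8 ⊗ (+ n ⊝ j) ⊕ (+ 8 ⊕ + w) ⊗ (+ 4 ⊗ H ⊗ H ⊝ + 2 ⊗ H ⊕ + 1) ⊗ m)
      (sym cube) (cong (+ 1 ⊕_) (sym (ℤ.pos-* 2 h)))))
  where
  H = + h
  identity : ∀ h w n → + 8 ⊗ (+ 1 ⊕ n) ⊕ w ≡
    + 8 ⊗ (n ⊝ h ⊗ h ⊗ h ⊗ (+ 8 ⊕ w)) ⊕ (+ 8 ⊕ w) ⊗ (+ 4 ⊗ h ⊗ h ⊝ + 2 ⊗ h ⊕ + 1) ⊗ (+ 1 ⊕ + 2 ⊗ h)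
  identity = solve-∀
  cube : + (h * h * h * (8 + w)) ≡ H ⊗ H ⊗ H ⊗ (+ 8 ⊕ + w)
  cube = trans (ℤ.pos-* (h * h * h) (8 + w)) (cong (_⊗ (+ 8 ⊕ + w))
    (trans (ℤ.pos-* (h * h) h) (cong (_⊗ H) (ℤ.pos-* h h))))

odd-^ : ∀ q k → Odd (suc (2 * q) ^ k)
odd-^ q zero = 0 , refl
odd-^ q (suc k) with odd-^ q k
... | h , eq = q + h + 2 * (q * h) , trans (cong (suc (2 * q) *_) eq) (identity q h)
  where
  identity : ∀ q h → (1 + 2 * q) * (1 + 2 * h) ≡ 1 + 2 * (q + h + 2 * (q * h))
  identity = ℕ-Solver.solve-∀

odd-prime : ∀ {p} → Prime p → p ≢ 2 → Odd p
odd-prime {p} pp p≢2 with even-or-odd p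
... | inj₂ odd      = odd
... | inj₁ (q , eq) with prime⇒irreducible pp (divides q (trans eq (*-comm 2 q)))
...   | inj₂ 2≡p = contradiction (sym 2≡p) p≢2

-- Multiplying A X² + B Y² + C Z² + ABC by ABC gives a value of the norm form of
-- (−BC, −AC), so it is enough that the form takes values close to −ABC.
universal⇒splitAt : ∀ a b c ε A B C e f g → NonZero ε → NonZero A → NonZero B → NonZero C →
  8 * a ≡ ε * A * (e * e) → 8 * b ≡ ε * B * (f * f) → c ≡ ε * C * (g * g) →
  AsymptoticallyUniversal (form a b c) → ∀ {p} → Prime p → p ≢ 2 → SplitAt p (B * C) (A * C)
universal⇒splitAt a b c ε A B C e f g ε≢0 A≢0 B≢0 C≢0 8a≡ 8b≡ c≡ universal {p} pp p≢2 =
  s , m*n≢0 ε (A * B * C) {{ε≢0}} {{m*n≢0 (A * B) C {{m*n≢0 A B {{A≢0}} {{B≢0}}}} {{C≢0}}}} , solution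
  where
  s = ε * (A * B * C)
  εℤ = + ε
  Aℤ = + A
  Bℤ = + B
  Cℤ = + C

  coefficient : ∀ A e x → + (ε * A * (e * e)) ⊗ (x ⊗ x) ≡ εℤ ⊗ + A ⊗ (+ e ⊗ x ⊗ (+ e ⊗ x))
  coefficient A e x = trans
    (cong (_⊗ (x ⊗ x)) (trans (ℤ.pos-* (ε * A) (e * e)) (cong₂ _⊗_ (ℤ.pos-* ε A) (ℤ.pos-* e e))))
    (identity (εℤ ⊗ + A) (+ e) x)
    where
    identity : ∀ a e x → a ⊗ (e ⊗ e) ⊗ (x ⊗ x) ≡ a ⊗ (e ⊗ x ⊗ (e ⊗ x))
    identity = solve-∀

  s≡ : + s ≡ εℤ ⊗ (Aℤ ⊗ Bℤ ⊗ Cℤ)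
  s≡ = trans (ℤ.pos-* ε (A * B * C)) (cong (εℤ ⊗_)
    (trans (ℤ.pos-* (A * B) C) (cong (_⊗ Cℤ) (ℤ.pos-* A B))))

  norm-identity : ∀ ε A B C X Y Z →
    ε ⊗ (A ⊗ B ⊗ C) ⊗ (ε ⊗ (A ⊗ B ⊗ C)) ⊕ B ⊗ C ⊗ (ε ⊗ A ⊗ X ⊗ (ε ⊗ A ⊗ X))
      ⊕ A ⊗ C ⊗ (ε ⊗ B ⊗ Y ⊗ (ε ⊗ B ⊗ Y)) ⊕ B ⊗ C ⊗ (A ⊗ C) ⊗ (ε ⊗ Z ⊗ (ε ⊗ Z)) ≡
    ε ⊗ (A ⊗ B ⊗ C) ⊗ (ε ⊗ A ⊗ (X ⊗ X) ⊕ ε ⊗ B ⊗ (Y ⊗ Y) ⊕ ε ⊗ C ⊗ (Z ⊗ Z) ⊕ ε ⊗ (A ⊗ B ⊗ C))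
  norm-identity = solve-∀

  regroup : ∀ n c s → + 8 ⊗ n ⊕ (c ⊕ s) ≡ + 8 ⊗ n ⊕ c ⊕ s
  regroup = solve-∀

  module _ (k h : ℕ) (p^k≡ : p ^ k ≡ suc (2 * h)) where

    M = suc (2 * h)

    -- 8 is invertible modulo the odd number p^k = 2 h + 1, and this residue makes 8 (n + 1) + c + s
    -- divisible by p^k.
    value : (∃ λ n → n % M ≡ (h * h * h * (8 + (c + s))) % M × Represents (form a b c) (suc n)) →
      ∃ λ x → ∃ λ y → ∃ λ z → + (p ^ k) ∣ℤ norm (+ (B * C)) (+ (A * C)) (+ s) x y z
    value (n , n≡ , x , y , z , n≡form) = x′ , y′ , z′ ,
      subst₂ _∣ℤ_ (cong +_ (sym p^k≡)) (sym norm≡) (∣n⇒∣m*n (+ s) (8n+8+w≡0 h (c + s) n n≡))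
      where
      w = z ⊕ z ⊕ + 1
      X = + e ⊗ x
      Y = + f ⊗ y
      Z = + g ⊗ w
      -- With these coordinates every term of the norm, s² included, contains the factor s = ε A B
      -- C.
      x′ = εℤ ⊗ Aℤ ⊗ X
      y′ = εℤ ⊗ Bℤ ⊗ Y
      z′ = εℤ ⊗ Z
      open ≡-Reasoning

      diagonal : + 8 ⊗ + suc n ⊕ + c ≡ εℤ ⊗ Aℤ ⊗ (X ⊗ X) ⊕ εℤ ⊗ Bℤ ⊗ (Y ⊗ Y) ⊕ εℤ ⊗ Cℤ ⊗ (Z ⊗ Z)
      diagonal = begin
        + 8 ⊗ + suc n ⊕ + c
          ≡⟨ cong (λ i → + 8 ⊗ i ⊕ + c) n≡form ⟩
        + 8 ⊗ form a b c x y z ⊕ + c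
          ≡⟨ form-completed a b c x y z ⟩
        + (8 * a) ⊗ (x ⊗ x) ⊕ + (8 * b) ⊗ (y ⊗ y) ⊕ + c ⊗ (w ⊗ w)
          ≡⟨ cong₂ _⊕_ (cong₂ (λ i j → + i ⊗ (x ⊗ x) ⊕ + j ⊗ (y ⊗ y)) 8a≡ 8b≡) (cong (λ i → + i ⊗ (w ⊗ w)) c≡) ⟩
        + (ε * A * (e * e)) ⊗ (x ⊗ x) ⊕ + (ε * B * (f * f)) ⊗ (y ⊗ y) ⊕ + (ε * C * (g * g)) ⊗ (w ⊗ w)
          ≡⟨ cong₂ _⊕_ (cong₂ _⊕_ (coefficient A e x) (coefficient B f y)) (coefficient C g w) ⟩
        εℤ ⊗ Aℤ ⊗ (X ⊗ X) ⊕ εℤ ⊗ Bℤ ⊗ (Y ⊗ Y) ⊕ εℤ ⊗ Cℤ ⊗ (Z ⊗ Z)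
          ∎

      D = εℤ ⊗ (Aℤ ⊗ Bℤ ⊗ Cℤ)

      norm≡ : norm (+ (B * C)) (+ (A * C)) (+ s) x′ y′ z′ ≡ + s ⊗ (+ 8 ⊗ + suc n ⊕ + (c + s))
      norm≡ = begin
        norm (+ (B * C)) (+ (A * C)) (+ s) x′ y′ z′
          ≡⟨ cong₂ (λ i j → norm i j (+ s) x′ y′ z′) (ℤ.pos-* B C) (ℤ.pos-* A C) ⟩
        norm (Bℤ ⊗ Cℤ) (Aℤ ⊗ Cℤ) (+ s) x′ y′ z′
          ≡⟨ cong (λ i → norm (Bℤ ⊗ Cℤ) (Aℤ ⊗ Cℤ) i x′ y′ z′) s≡ ⟩
        norm (Bℤ ⊗ Cℤ) (Aℤ ⊗ Cℤ) D x′ y′ z′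
          ≡⟨ norm-identity εℤ Aℤ Bℤ Cℤ X Y Z ⟩
        D ⊗ (εℤ ⊗ Aℤ ⊗ (X ⊗ X) ⊕ εℤ ⊗ Bℤ ⊗ (Y ⊗ Y) ⊕ εℤ ⊗ Cℤ ⊗ (Z ⊗ Z) ⊕ D)
          ≡⟨ cong₂ (λ i j → i ⊗ (j ⊕ i)) (sym s≡) (sym diagonal) ⟩
        + s ⊗ (+ 8 ⊗ + suc n ⊕ + c ⊕ + s)
          ≡⟨ cong (+ s ⊗_) (regroup (+ suc n) (+ c) (+ s)) ⟨
        + s ⊗ (+ 8 ⊗ + suc n ⊕ + (c + s))
          ∎

  solution : ∀ k → ∃ λ x → ∃ λ y → ∃ λ z → + (p ^ k) ∣ℤ norm (+ (B * C)) (+ (A * C)) (+ s) x y z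
  solution k with odd-prime pp p≢2
  ... | q , refl with odd-^ q k
  ...   | h , p^k≡ = value k h p^k≡ (represents-every-class {form a b c} universal (suc (2 * h)) (h * h * h * (8 + (c + s))))

-- 2-adic square classes

odd-nonZero : ∀ {n} → Odd n → NonZero n
odd-nonZero (_ , refl) = _

odd-mod-4 : ∀ {n} → Odd n → (∃ λ q → n ≡ 1 + 4 * q) ⊎ (∃ λ q → n ≡ 3 + 4 * q)
odd-mod-4 (h , refl) with even-or-odd h
... | inj₁ (q , refl) = inj₁ (q , identity q)
  where
  identity : ∀ q → 1 + 2 * (2 * q) ≡ 1 + 4 * q
  identity = ℕ-Solver.solve-∀
... | inj₂ (q , refl) = inj₂ (q , identity q)
  where
  identity : ∀ q → 1 + 2 * (1 + 2 * q) ≡ 3 + 4 * q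
  identity = ℕ-Solver.solve-∀

odd-* : ∀ {m n} → Odd m → Odd n → Odd (m * n)
odd-* (h , refl) (k , refl) = h + k + 2 * (h * k) , identity h k
  where
  identity : ∀ h k → (1 + 2 * h) * (1 + 2 * k) ≡ 1 + 2 * (h + k + 2 * (h * k))
  identity = ℕ-Solver.solve-∀

1*3≡3-mod-4 : ∀ q r → (1 + 4 * q) * (3 + 4 * r) ≡ 3 + 4 * (3 * q + r + 4 * (q * r))
1*3≡3-mod-4 = ℕ-Solver.solve-∀

[r+4q]%4≡r%4 : ∀ r q → (r + 4 * q) % 4 ≡ r % 4
[r+4q]%4≡r%4 r q = trans (cong (λ n → (r + n) % 4) (*-comm 4 q)) ([m+kn]%n≡m%n r q 4)

≡-or-product≡3 : ∀ {m n} → Odd m → Odd n → m ≡ n [mod 4 ] ⊎ (∃ λ i → m * n ≡ 3 + 4 * i)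
≡-or-product≡3 {m} {n} om on with odd-mod-4 om | odd-mod-4 on
... | inj₁ (q , refl) | inj₁ (r , refl) = inj₁ (trans ([r+4q]%4≡r%4 1 q) (sym ([r+4q]%4≡r%4 1 r)))
... | inj₂ (q , refl) | inj₂ (r , refl) = inj₁ (trans ([r+4q]%4≡r%4 3 q) (sym ([r+4q]%4≡r%4 3 r)))
... | inj₁ (q , refl) | inj₂ (r , refl) = inj₂ (3 * q + r + 4 * (q * r) , 1*3≡3-mod-4 q r)
... | inj₂ (q , refl) | inj₁ (r , refl) = inj₂ (3 * r + q + 4 * (r * q) , trans (*-comm m n) (1*3≡3-mod-4 r q))

splitAt-2′ : ∀ {m n} → (∃ λ i → m ≡ 3 + 4 * i) → Odd n → SplitAt 2 m n
splitAt-2′ (i , refl) (h , refl) = splitAt-2 i h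

-- If neither B C nor A C is 3 modulo 4, then B and A both agree with C modulo 4, which is excluded.
-- An entry that is 3 modulo 4 splits at 2 against any odd entry.
splitAt-2-of-odd : ∀ {A B C} → Odd A → Odd B → Odd C → ¬ (A ≡ B [mod 4 ] × B ≡ C [mod 4 ]) →
  SplitAt 2 (B * C) (A * C)
splitAt-2-of-odd {A} {B} {C} oA oB oC A≢B≢C with ≡-or-product≡3 oB oC | ≡-or-product≡3 oA oC
... | inj₂ BC≡3 | _         = splitAt-2′ BC≡3 (odd-* oA oC)
... | inj₁ _    | inj₂ AC≡3 = splitAt-swap 2 (A * C) (B * C) (splitAt-2′ AC≡3 (odd-* oB oC))
... | inj₁ B≡C  | inj₁ A≡C  = contradiction (trans A≡C (sym B≡C) , B≡C) A≢B≢C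

-- The completed square has coefficients 8 a, 8 b, c; these are A, B, C up to the common factor ε
-- and the squares e², f², g². A universal form would make the definite algebra (-BC, -AC) split at
-- every prime.
¬universal : ∀ a b c ε A B C e f g → NonZero ε → Odd A → Odd B → Odd C →
  ¬ (A ≡ B [mod 4 ] × B ≡ C [mod 4 ]) →
  8 * a ≡ ε * A * (e * e) → 8 * b ≡ ε * B * (f * f) → c ≡ ε * C * (g * g) →
  ¬ AsymptoticallyUniversal (form a b c)
¬universal a b c ε A B C e f g ε≢0 oA oB oC A≢B≢C 8a≡ 8b≡ c≡ universal =
  ¬split-everywhere (B * C + A * C) (B * C) (A * C)
    (odd-nonZero (odd-* oB oC)) (odd-nonZero (odd-* oA oC)) ≤-refl split
  where
  split : ∀ p → Prime p → SplitAt p (B * C) (A * C)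
  split p pp with p ≟ 2
  ... | yes refl = splitAt-2-of-odd oA oB oC A≢B≢C
  ... | no  p≢2  = universal⇒splitAt a b c ε A B C e f g ε≢0
                     (odd-nonZero oA) (odd-nonZero oB) (odd-nonZero oC) 8a≡ 8b≡ c≡ universal pp p≢2

-- Halving a nonzero n makes it strictly smaller, so a bound k ≥ n leaves enough divisions to reach
-- an odd number.
v₂-bounded-odd : ∀ k n → NonZero n → n ≤ k → ∃ λ m → Odd m × n ≡ m * 2 ^ v₂-bounded k n
v₂-bounded-odd zero    zero () z≤n
v₂-bounded-odd (suc k) n n≢0 n≤k with 2 ∣? n
... | no 2∤n = n , odd (even-or-odd n) , sym (*-identityʳ n)
  where
  odd : (∃ λ q → n ≡ 2 * q) ⊎ Odd n → Odd n
  odd (inj₁ (q , n≡)) = contradiction (divides q (trans n≡ (*-comm 2 q))) 2∤n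
  odd (inj₂ o) = o
... | yes (divides q n≡) = halve (v₂-bounded-odd k (n / 2) (subst NonZero (sym n/2≡) q≢0) n/2≤k)
  where
  n/2≡ : n / 2 ≡ q
  n/2≡ = trans (cong (_/ 2) n≡) (m*n/n≡m q 2)
  q≢0 : NonZero q
  q≢0 = m*n≢0⇒m≢0 q {{subst NonZero n≡ n≢0}}
  n/2≤k : n / 2 ≤ k
  n/2≤k = s≤s⁻¹ (≤-trans (subst₂ _<_ (sym n/2≡) (sym n≡) (m<m*n q 2 {{q≢0}} (s≤s (s≤s z≤n)))) n≤k)
  halve : (∃ λ m → Odd m × n / 2 ≡ m * 2 ^ v₂-bounded k (n / 2)) →
          ∃ λ m → Odd m × n ≡ m * 2 ^ suc (v₂-bounded k (n / 2))
  halve (m , o , eq) = m , o , (begin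
    n                                       ≡⟨ n≡ ⟩
    q * 2                                   ≡⟨ cong (_* 2) (trans (sym n/2≡) eq) ⟩
    m * 2 ^ v₂-bounded k (n / 2) * 2        ≡⟨ *-assoc m (2 ^ v₂-bounded k (n / 2)) 2 ⟩
    m * (2 ^ v₂-bounded k (n / 2) * 2)      ≡⟨ cong (m *_) (*-comm (2 ^ v₂-bounded k (n / 2)) 2) ⟩
    m * 2 ^ suc (v₂-bounded k (n / 2))      ∎)
    where open ≡-Reasoning

odd-oddPart : ∀ n → NonZero n → Odd (oddPart n) × n ≡ oddPart n * 2 ^ v₂ n
odd-oddPart n n≢0 with v₂-bounded-odd n n n≢0 ≤-refl
... | m , o , n≡ = subst Odd (sym eq) o , trans n≡ (cong (_* 2 ^ v₂ n) (sym eq))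
  where
  eq : oddPart n ≡ m
  eq = trans (cong (λ i → _/_ i (2 ^ v₂ n) {{m^n≢0 2 (v₂ n)}}) n≡)
             (m*n/n≡m m (2 ^ v₂ n) {{m^n≢0 2 (v₂ n)}})

2^-parity : ∀ v → 2 ^ v ≡ 2 ^ (v % 2) * (2 ^ (v / 2) * 2 ^ (v / 2))
2^-parity v = begin
  2 ^ v                                            ≡⟨ cong (2 ^_) (m≡m%n+[m/n]*n v 2) ⟩
  2 ^ (v % 2 + v / 2 * 2)                          ≡⟨ ^-distribˡ-+-* 2 (v % 2) (v / 2 * 2) ⟩
  2 ^ (v % 2) * 2 ^ (v / 2 * 2)                    ≡⟨ cong (2 ^ (v % 2) *_) (^-*-assoc 2 (v / 2) 2) ⟨
  2 ^ (v % 2) * (2 ^ (v / 2)) ^ 2                  ≡⟨ cong (λ i → 2 ^ (v % 2) * (2 ^ (v / 2) * i)) (*-identityʳ _) ⟩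
  2 ^ (v % 2) * (2 ^ (v / 2) * 2 ^ (v / 2))        ∎
  where open ≡-Reasoning

-- Only the parity of the 2-adic order survives modulo squares; the even part of the exponent goes
-- into u².
SquareClass : ℕ → Set
SquareClass n = Odd (oddPart n) × ∃ λ u → n ≡ 2 ^ (v₂ n % 2) * oddPart n * (u * u)

square-class : ∀ n .{{_ : NonZero n}} → SquareClass n
square-class n with odd-oddPart n (≢-nonZero (≢-nonZero⁻¹ n))
... | o , n≡ = o , u , (begin
  n                                              ≡⟨ n≡ ⟩
  oddPart n * 2 ^ v₂ n                           ≡⟨ cong (oddPart n *_) (2^-parity (v₂ n)) ⟩
  oddPart n * (2 ^ (v₂ n % 2) * (u * u))         ≡⟨ identity (oddPart n) (2 ^ (v₂ n % 2)) (u * u) ⟩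
  2 ^ (v₂ n % 2) * oddPart n * (u * u)           ∎)
  where
  u = 2 ^ (v₂ n / 2)
  open ≡-Reasoning
  identity : ∀ m d s → m * (d * s) ≡ d * m * s
  identity = ℕ-Solver.solve-∀

-- Choice of the pair of forms

module _ {a b c A B C : ℕ} (u v w : ℕ) (oA : Odd A) (oB : Odd B) (oC : Odd C)
         (A≢B≢C : ¬ (A ≡ B [mod 4 ] × B ≡ C [mod 4 ])) where

  private
    A≢C≢B : ¬ (A ≡ C [mod 4 ] × C ≡ B [mod 4 ])
    A≢C≢B (A≡C , C≡B) = A≢B≢C (trans A≡C C≡B , sym C≡B)

    scale-8 : ∀ d A u → 8 * (d * A * (u * u)) ≡ 2 * d * A * (2 * u * (2 * u))
    scale-8 = ℕ-Solver.solve-∀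

    scale-2 : ∀ d A u → 2 * (d * A * (u * u)) ≡ 2 * d * A * (u * u)
    scale-2 = ℕ-Solver.solve-∀

    scale-16 : ∀ d A u → 8 * (2 * (d * A * (u * u))) ≡ d * A * (4 * u * (4 * u))
    scale-16 = ℕ-Solver.solve-∀

    double-8 : ∀ A u → 8 * (2 * A * (u * u)) ≡ 1 * A * (4 * u * (4 * u))
    double-8 = ℕ-Solver.solve-∀

  -- When all three orders have the same parity, 8 a, 8 b and 2 c share the factor 2 d up to
  -- squares, and so do 8 a, 8 c and 2 b.
  ¬universal-same : ∀ d → NonZero d → a ≡ d * A * (u * u) → b ≡ d * B * (v * v) → c ≡ d * C * (w * w) →
    ¬ AsymptoticallyUniversal (form a b (2 * c)) × ¬ AsymptoticallyUniversal (form a c (2 * b))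
  ¬universal-same d d≢0 a≡ b≡ c≡ =
    ¬universal a b (2 * c) (2 * d) A B C (2 * u) (2 * v) w 2d≢0 oA oB oC A≢B≢C 8a≡ 8b≡ 2c≡ ,
    ¬universal a c (2 * b) (2 * d) A C B (2 * u) (2 * w) v 2d≢0 oA oC oB A≢C≢B 8a≡ 8c≡ 2b≡
    where
    2d≢0 : NonZero (2 * d)
    2d≢0 = m*n≢0 2 d {{_}} {{d≢0}}
    8a≡ = trans (cong (8 *_) a≡) (scale-8 d A u)
    8b≡ = trans (cong (8 *_) b≡) (scale-8 d B v)
    8c≡ = trans (cong (8 *_) c≡) (scale-8 d C w)
    2b≡ = trans (cong (2 *_) b≡) (scale-2 d B v)
    2c≡ = trans (cong (2 *_) c≡) (scale-2 d C w)

  -- Doubling moves to the square variable: 16 c is C times d up to squares, just as b is B times d.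
  -- The factor 8 reverses the parity of the order of a, so 8 a joins them.
  ¬universal-opposite : ∀ d e → NonZero d → 8 * a ≡ d * A * (e * e) → b ≡ d * B * (v * v) → c ≡ d * C * (w * w) →
    ¬ AsymptoticallyUniversal (form a (2 * c) b) × ¬ AsymptoticallyUniversal (form a (2 * b) c)
  ¬universal-opposite d e d≢0 8a≡ b≡ c≡ =
    ¬universal a (2 * c) b d A C B e (4 * w) v d≢0 oA oC oB A≢C≢B 8a≡ 16c≡ b≡ ,
    ¬universal a (2 * b) c d A B C e (4 * v) w d≢0 oA oB oC A≢B≢C 8a≡ 16b≡ c≡
    where
    16b≡ = trans (cong (λ i → 8 * (2 * i)) b≡) (scale-16 d B v)
    16c≡ = trans (cong (λ i → 8 * (2 * i)) c≡) (scale-16 d C w)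

  ¬universal-either : ∀ i j → i < 2 → j < 2 →
    a ≡ 2 ^ i * A * (u * u) → b ≡ 2 ^ j * B * (v * v) → c ≡ 2 ^ j * C * (w * w) →
    (¬ AsymptoticallyUniversal (form a b (2 * c)) × ¬ AsymptoticallyUniversal (form a c (2 * b)))
    ⊎ (¬ AsymptoticallyUniversal (form a (2 * c) b) × ¬ AsymptoticallyUniversal (form a (2 * b) c))
  ¬universal-either 0 0 _ _ a≡ b≡ c≡ = inj₁ (¬universal-same 1 _ a≡ b≡ c≡)
  ¬universal-either 1 1 _ _ a≡ b≡ c≡ = inj₁ (¬universal-same 2 _ a≡ b≡ c≡)
  -- 8 · 2 A u² = A (4 u)², so the common factor is 1.
  ¬universal-either 1 0 _ _ a≡ b≡ c≡ = inj₂ (¬universal-opposite 1 (4 * u) _ (trans (cong (8 *_) a≡) (double-8 A u)) b≡ c≡)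
  -- 8 A u² = 2 A (2 u)², so the common factor is 2.
  ¬universal-either 0 1 _ _ a≡ b≡ c≡ = inj₂ (¬universal-opposite 2 (2 * u) _ (trans (cong (8 *_) a≡) (scale-8 1 A u)) b≡ c≡)
  ¬universal-either (suc (suc _)) _ (s≤s (s≤s ())) _ _ _ _
  ¬universal-either _ (suc (suc _)) _ (s≤s (s≤s ())) _ _ _

corollary1p5 : (a b c : ℕ) .{{_ : NonZero a}} .{{_ : NonZero b}} .{{_ : NonZero c}} →
    v₂ b ≡ v₂ c [mod 2 ] →
    ¬ (oddPart a ≡ oddPart b [mod 4 ] × oddPart b ≡ oddPart c [mod 4 ]) →
    (¬ AsymptoticallyUniversal (form a b (2 * c)) × ¬ AsymptoticallyUniversal (form a c (2 * b)))
    ⊎ (¬ AsymptoticallyUniversal (form a (2 * c) b) × ¬ AsymptoticallyUniversal (form a (2 * b) c))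
corollary1p5 a b c v₂b≡v₂c A≢B≢C = combine (square-class a) (square-class b) (square-class c)
  where
  combine : SquareClass a → SquareClass b → SquareClass c → _
  combine (oA , u , a≡) (oB , v , b≡) (oC , w , c≡) =
    ¬universal-either u v w oA oB oC A≢B≢C (v₂ a % 2) (v₂ b % 2) (m%n<n (v₂ a) 2) (m%n<n (v₂ b) 2) a≡ b≡
      -- The parity hypothesis lets c carry the same power of 2 as b.
      (trans c≡ (cong (λ i → 2 ^ i * oddPart c * (w * w)) (sym v₂b≡v₂c)))
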